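{- Let $M=(E,\rho)$ be a binary simple $(n,k,d)$-matroid with no isthmuses. If $\mathcal{Z}(M)$ has height 3, then either $\eta(E)=2$ or $M$ is isomorphic to one of the following matroids: (a) the $(6,3,3)$-matroid (whose lattice of cyclic flats has 4 atoms), namely the column matroid over $\mathbb{F}_2$ of $\begin{pmatrix}1&0&0&1&1&1\\0&1&0&1&0&1\\0&0&1&0&1&1\end{pmatrix}$; (b) the $(7,3,4)$-matroid (with 7 atoms), namely the column matroid over $\mathbb{F}_2$ of the $3\times 7$ matrix whose columns are all nonzero vectors of $\mathbb{F}_2^3$; (c) the $(7,4,3)$-matroid (with 7 atoms), namely the dual of the matroid in (b); (d) the $(8,4,4)$-matroid (with 14 atoms), namely the column matroid over $\mathbb{F}_2$ of $\begin{pmatrix}1&0&0&0&1&0&1&1\\0&1&0&0&1&1&0&1\\0&0&1&0&1&1&1&0\\0&0&0&1&0&1&1&1\end{pmatrix}$.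
   Context: A matroid is binary if representable over $\mathbb{F}_2$; simple means no loops and no parallel elements; an isthmus is an element $e$ with $\rho(E-e)<\rho(E)$. $\eta(X)=|X|-\rho(X)$. An $(n,k,d)$-matroid has $|E|=n$, $\rho(E)=k$ and minimum distance $d=\min\{|X|:X\subseteq E,\ \rho(E-X)<\rho(E)\}$. The dual $M^*$ has rank function $\rho^*(A)=|A|+\rho(E-A)-\rho(E)$. $\mathcal{Z}(M)$ is the lattice (under inclusion) of cyclic flats, i.e. sets $X$ with $\mathrm{cl}(X)=X$ and $\mathrm{cyc}(X)=X$, where $\mathrm{cl}(X)=\{e:\rho(X\cup e)=\rho(X)\}$ and $\mathrm{cyc}(X)=\{e\in X:\rho(X-e)=\rho(X)\}$. "Height 3" means the longest chains in $\mathcal{Z}(M)$ consist of three elements $0_{\mathcal{Z}}\subsetneq Z\subsetneq 1_{\mathcal{Z}}$. -}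

module Defs where

open import Data.Bool using (Bool; true; false; _∧_; _∨_; _xor_; not; if_then_else_)
open import Data.Nat using (ℕ; zero; suc; _+_; _∸_; _≤_; _<_; _⊔_)
open import Data.Fin using (Fin)
open import Data.Fin.Subset using (Subset; ⊤; ⊥; ⁅_⁆; _∈_; _∉_; _⊆_; _⊂_; _∪_; _∩_; _─_; _-_; ∣_∣; ∁)
open import Data.Vec using (Vec; []; _∷_; lookup; map; replicate; zipWith; foldr; tabulate)
open import Data.List using (List; []; _∷_; _++_) renaming (map to mapL; foldr to foldrL)
open import Data.Product using (Σ; ∃; _×_; _,_)
open import Data.Sum using (_⊎_)
open import Relation.Binary.PropositionalEquality using (_≡_; _≢_)
open import Function.Bundles using (_⤖_; Bijection)

record Matroid (n : ℕ) : Set where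
  field
    ρ        : Subset n → ℕ
    bounded  : ∀ X → ρ X ≤ ∣ X ∣
    monotone : ∀ {X Y} → X ⊆ Y → ρ X ≤ ρ Y
    submod   : ∀ X Y → ρ (X ∪ Y) + ρ (X ∩ Y) ≤ ρ X + ρ Y

open Matroid public

allSubsets : (n : ℕ) → List (Subset n)
allSubsets zero    = [] ∷ []
allSubsets (suc n) = mapL (true ∷_) (allSubsets n) ++ mapL (false ∷_) (allSubsets n)

_⊆ᵇ_ : ∀ {n} → Subset n → Subset n → Bool
[]      ⊆ᵇ []      = true
(x ∷ X) ⊆ᵇ (y ∷ Y) = (not x ∨ y) ∧ (X ⊆ᵇ Y)

nonEmptyᵇ : ∀ {n} → Subset n → Bool
nonEmptyᵇ = foldr _ _∨_ false

isZeroᵇ : ∀ {r} → Vec Bool r → Bool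
isZeroᵇ v = not (foldr _ _∨_ false v)

zeroVec : ∀ {r} → Vec Bool r
zeroVec = replicate _ false

sumOver : ∀ {n r} → (Fin n → Vec Bool r) → Subset n → Vec Bool r
sumOver {n} v Z = go Z v
  where
  go : ∀ {m} → Subset m → (Fin m → Vec Bool _) → Vec Bool _
  go []            w = zeroVec
  go (true  ∷ Z′) w = zipWith _xor_ (w Fin.zero) (go Z′ (λ i → w (Fin.suc i)))
  go (false ∷ Z′) w = go Z′ (λ i → w (Fin.suc i))

-- {v i | i ∈ Y} is linearly independent over F₂ (and the v i, i ∈ Y,
-- are pairwise distinct as a family): no nonempty Z ⊆ Y has ∑_{i∈Z} v i = 0.
-- (Over F₂ a linear combination is exactly a subset sum.)
independentᵇ : ∀ {n r} → (Fin n → Vec Bool r) → Subset n → Bool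
independentᵇ {n} v Y =
  foldrL (λ Z b → (not (Z ⊆ᵇ Y ∧ nonEmptyᵇ Z) ∨ not (isZeroᵇ (sumOver v Z))) ∧ b)
         true (allSubsets n)

rankF2 : ∀ {n r} → (Fin n → Vec Bool r) → Subset n → ℕ
rankF2 {n} v X =
  foldrL (λ Y m → (if (Y ⊆ᵇ X) ∧ independentᵇ v Y then ∣ Y ∣ else 0) ⊔ m)
         0 (allSubsets n)

column : ∀ {r n} → Vec (Vec Bool n) r → Fin n → Vec Bool r
column A j = map (λ row → lookup row j) A

colRank : ∀ {r n} → Vec (Vec Bool n) r → Subset n → ℕ
colRank A = rankF2 (column A)

dualRank : ∀ {n} → (Subset n → ℕ) → Subset n → ℕ
dualRank ρ′ X = ∣ X ∣ + ρ′ (∁ X) ∸ ρ′ ⊤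

module _ {n : ℕ} (M : Matroid n) where

  Binary : Set
  Binary = Σ ℕ λ r → Σ (Fin n → Vec Bool r) λ v → ∀ X → ρ M X ≡ rankF2 v X

  Loop : Fin n → Set
  Loop e = ρ M ⁅ e ⁆ ≡ 0

  Parallel : Fin n → Fin n → Set
  Parallel e f = e ≢ f × ρ M (⁅ e ⁆ ∪ ⁅ f ⁆) ≡ 1

  Simple : Set
  Simple = (∀ e → ¬' (Loop e)) × (∀ e f → ¬' (Parallel e f))
    where
    open import Relation.Nullary using () renaming (¬_ to ¬'_)

  Isthmus : Fin n → Set
  Isthmus e = ρ M (⊤ - e) < ρ M ⊤

  η : Subset n → ℕ
  η X = ∣ X ∣ ∸ ρ M X

  Flat : Subset n → Set
  Flat X = ∀ e → ρ M (X ∪ ⁅ e ⁆) ≡ ρ M X → e ∈ X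

  Cyclic : Subset n → Set
  Cyclic X = ∀ e → e ∈ X → ρ M (X - e) ≡ ρ M X

  CyclicFlat : Subset n → Set
  CyclicFlat X = Flat X × Cyclic X

  Chain3 : Set
  Chain3 = Σ (Subset n) λ X → Σ (Subset n) λ Y → Σ (Subset n) λ W →
           CyclicFlat X × CyclicFlat Y × CyclicFlat W × X ⊂ Y × Y ⊂ W

  Chain4 : Set
  Chain4 = Σ (Subset n) λ X → Σ (Subset n) λ Y → Σ (Subset n) λ W → Σ (Subset n) λ V →
           CyclicFlat X × CyclicFlat Y × CyclicFlat W × CyclicFlat V ×
           X ⊂ Y × Y ⊂ W × W ⊂ V

  Height3 : Set
  Height3 = Chain3 × (Chain4 → Data.Empty.⊥)
    where import Data.Empty

  IsoTo : ∀ {m} → (Subset m → ℕ) → Set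
  IsoTo {m} ρN = Σ (Fin n ⤖ Fin m) λ σ →
    ∀ (Y : Subset m) → ρN Y ≡ ρ M (tabulate (λ i → lookup Y (Bijection.to σ i)))

private
  pattern O = false
  pattern I = true

A₆ : Vec (Vec Bool 6) 3
A₆ = (I ∷ O ∷ O ∷ I ∷ I ∷ I ∷ [])
   ∷ (O ∷ I ∷ O ∷ I ∷ O ∷ I ∷ [])
   ∷ (O ∷ O ∷ I ∷ O ∷ I ∷ I ∷ [])
   ∷ []

-- (b) the (7,3,4)-matroid: columns are all nonzero vectors of F₂³
F₇ : Vec (Vec Bool 7) 3
F₇ = (I ∷ O ∷ O ∷ I ∷ I ∷ O ∷ I ∷ [])
   ∷ (O ∷ I ∷ O ∷ I ∷ O ∷ I ∷ I ∷ [])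
   ∷ (O ∷ O ∷ I ∷ O ∷ I ∷ I ∷ I ∷ [])
   ∷ []

A₈ : Vec (Vec Bool 8) 4
A₈ = (I ∷ O ∷ O ∷ O ∷ I ∷ O ∷ I ∷ I ∷ [])
   ∷ (O ∷ I ∷ O ∷ O ∷ I ∷ I ∷ O ∷ I ∷ [])
   ∷ (O ∷ O ∷ I ∷ O ∷ I ∷ I ∷ I ∷ O ∷ [])
   ∷ (O ∷ O ∷ O ∷ I ∷ O ∷ I ∷ I ∷ I ∷ [])
   ∷ []

ρa : Subset 6 → ℕ
ρa = colRank A₆

ρb : Subset 7 → ℕ
ρb = colRank F₇

ρc : Subset 7 → ℕ
ρc = dualRank ρb

ρd : Subset 8 → ℕ
ρd = colRank A₈

{-# OPTIONS --safe #-}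
module Submission where

-- Fix vectors v e representing M. Once η(E) ≠ 2, minimality arguments in the contraction by a
-- circuit Z that is a proper flat force all elements outside a circuit C to be congruent modulo
-- span C (trivially so when C spans), and at least three elements lie outside Z. For e ≠ f outside
-- Z write v e + v f as the sum of some S ⊂ Z; then {e, f} ∪ S is again a circuit, and congruence
-- modulo it gives |Z ∖ S| ≤ 2, likewise |S| ≤ 2, so |Z| is 3 or 4. If Z = {a, b, c}, every v g lies
-- in the span of v a, v b, v e, so M embeds in the Fano matroid F₇; if Z = {a, b, c, d}, all S have
-- two elements, so every v g is a sum of an odd number of v a, v b, v c, v e, and M embeds in the
-- matroid (d). At most one element is missed, and all one-element deletions of these two matroids
-- are isomorphic to (a) and (c) respectively.

open import Defs
open import Algebra.Bundles using (CommutativeMonoid)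
import Algebra.Properties.CommutativeMonoid.Sum as Sum
open import Data.Bool using (Bool; true; false; _∧_; _∨_; _xor_; not; if_then_else_)
import Data.Bool.Properties as Bool
open import Data.Nat using (ℕ; zero; suc; _+_; _∸_; _≤_; _<_; _≡ᵇ_; _⊔_; s≤s⁻¹; _≤?_)
import Data.Nat.Properties as ℕ
open import Data.Nat.Induction using (<-wellFounded)
open import Induction.WellFounded using (Acc; acc)
open import Data.Fin using (Fin; zero; suc; #_; punchOut)
import Data.Fin.Properties as Fin
open import Data.Fin.Permutation using (Permutation; permutation; _⟨$⟩ʳ_; _⟨$⟩ˡ_; inverseˡ; inverseʳ; flip)
open import Data.Fin.Subset renaming (⊥ to ∅)
open import Data.Fin.Subset.Properties
open import Data.Vec using (Vec; []; _∷_; lookup; tabulate; zipWith; here; there)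
import Data.Vec as Vector
import Data.Vec.Properties as Vec
open import Data.Vec.Membership.Propositional using () renaming (_∈_ to _∈ᵛ_)
open import Data.Vec.Relation.Unary.Any using (here; there)
open import Data.Vec.Relation.Unary.All using (All; []; _∷_)
import Data.Vec.Relation.Unary.All as All
open import Data.Vec.Relation.Unary.All.Properties using (lookup⁺)
open import Data.Vec.Relation.Unary.AllPairs using ([]; _∷_)
open import Data.Vec.Relation.Unary.Unique.Propositional using (Unique)
open import Data.Vec.Relation.Unary.Unique.Propositional.Properties using (lookup-injective)
open import Data.List using (List; []; _∷_; foldr)
open import Data.List.Membership.Propositional using () renaming (_∈_ to _∈ˡ_)
open import Data.List.Membership.Propositional.Properties using (∈-++⁺ˡ; ∈-++⁺ʳ; ∈-map⁺)
open import Data.List.Relation.Unary.Any using (here; there)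
open import Data.Product using (∃-syntax; _×_; _,_; proj₁; proj₂)
open import Data.Sum using (_⊎_; inj₁; inj₂; [_,_]′) renaming (map to map⊎)
open import Data.Empty using (⊥; ⊥-elim)
open import Function using (_∘_; id; Injective; Equivalence)
open import Function.Properties.Inverse using (↔⇒⤖)
open import Relation.Nullary using (Dec; yes; no; ¬_; contradiction; does)
open import Relation.Nullary.Decidable
  using (_×-dec_; _⊎-dec_; _→-dec_; ¬?; map′; decidable-stable; dec-true; toWitness; toWitnessFalse)
open import Relation.Nullary.Reflects using (Reflects; ofʸ; ofⁿ; invert; _×-reflects_; _⊎-reflects_; ¬-reflects)
open import Relation.Binary.PropositionalEquality
  using (_≡_; _≢_; refl; sym; trans; cong; cong₂; subst; isEquivalence; module ≡-Reasoning)

-- Height 3 is used in one form only: without loops and isthmuses the empty set and E are cyclic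
-- flats, so two distinct nested nonempty cyclic flats cannot both be proper. Closures of cycles are
-- cyclic flats. Hence every cycle inside the closure of a nonspanning circuit spans that circuit,
-- and every cycle of the contraction by Z spans E together with Z. In both settings one argument
-- applies: an element spanned by a circuit and not on it is parallel to an element of the circuit.
-- In the first setting simplicity turns this into flatness of the circuit; in the second it makes
-- all elements outside Z parallel in the contraction. The second setting needs an element outside
-- both Z and a circuit T of the contraction; if there is none, E is the union of Z and T, and η(E)
-- = 2. The rank of M is then one more than that of Z, so it equals |Z|, which is why the target
-- matroids live in dimensions 3 and 4.

private
  variable
    n m r k : ℕ

-- Vectors over F₂, symmetric difference and subset sums

infixr 6 _⊕_
_⊕_ : Vec Bool r → Vec Bool r → Vec Bool r
_⊕_ = zipWith _xor_

⊕-assoc : (a b c : Vec Bool r) → (a ⊕ b) ⊕ c ≡ a ⊕ (b ⊕ c)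
⊕-assoc = Vec.zipWith-assoc Bool.xor-assoc

⊕-comm : (a b : Vec Bool r) → a ⊕ b ≡ b ⊕ a
⊕-comm = Vec.zipWith-comm Bool.xor-comm

⊕-identityˡ : (a : Vec Bool r) → zeroVec ⊕ a ≡ a
⊕-identityˡ = Vec.zipWith-identityˡ Bool.xor-identityˡ

⊕-identityʳ : (a : Vec Bool r) → a ⊕ zeroVec ≡ a
⊕-identityʳ = Vec.zipWith-identityʳ Bool.xor-identityʳ

⊕-self : (a : Vec Bool r) → a ⊕ a ≡ zeroVec
⊕-self []      = refl
⊕-self (x ∷ a) = cong₂ _∷_ (Bool.xor-same x) (⊕-self a)

⊕-cancel : (a b : Vec Bool r) → a ⊕ (a ⊕ b) ≡ b
⊕-cancel a b = trans (sym (⊕-assoc a a b)) (trans (cong (_⊕ b) (⊕-self a)) (⊕-identityˡ b))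

⊕-leftComm : (a b c : Vec Bool r) → a ⊕ (b ⊕ c) ≡ b ⊕ (a ⊕ c)
⊕-leftComm a b c = trans (sym (⊕-assoc a b c)) (trans (cong (_⊕ c) (⊕-comm a b)) (⊕-assoc b a c))

⊕-interchange : (a b c d : Vec Bool r) → (a ⊕ b) ⊕ (c ⊕ d) ≡ (a ⊕ c) ⊕ (b ⊕ d)
⊕-interchange a b c d = trans (⊕-assoc a b _) (trans (cong (a ⊕_) (⊕-leftComm b c d)) (sym (⊕-assoc a c _)))

⊕≡0⇒≡ : {a b : Vec Bool r} → a ⊕ b ≡ zeroVec → a ≡ b
⊕≡0⇒≡ {a = a} {b} eq = trans (sym (⊕-identityʳ a)) (trans (cong (a ⊕_) (sym eq)) (⊕-cancel a b))

≡⇒⊕≡0 : {a b : Vec Bool r} → a ≡ b → a ⊕ b ≡ zeroVec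
≡⇒⊕≡0 {b = b} refl = ⊕-self b

⊕-commutativeMonoid : ℕ → CommutativeMonoid _ _
⊕-commutativeMonoid r = record
  { Carrier = Vec Bool r ; _≈_ = _≡_ ; _∙_ = _⊕_ ; ε = zeroVec
  ; isCommutativeMonoid = record
    { isMonoid = record
      { isSemigroup = record
        { isMagma = record
          { isEquivalence = isEquivalence
          ; ∙-cong = cong₂ _⊕_ }
        ; assoc = ⊕-assoc }
      ; identity = ⊕-identityˡ , ⊕-identityʳ }
    ; comm = ⊕-comm } }

-- On subsets, _⊕_ is symmetric difference.
∈⊕⁻ : {A B : Subset n} {x : Fin n} → x ∈ A ⊕ B → (x ∈ A × x ∉ B) ⊎ (x ∉ A × x ∈ B)
∈⊕⁻ {A = true ∷ A}  {false ∷ B} here = inj₁ (here , λ ())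
∈⊕⁻ {A = false ∷ A} {true ∷ B}  here = inj₂ ((λ ()) , here)
∈⊕⁻ {A = a ∷ A} {b ∷ B} (there x∈) with ∈⊕⁻ {A = A} {B} x∈
... | inj₁ (p , q) = inj₁ (there p , q ∘ drop-there)
... | inj₂ (p , q) = inj₂ (p ∘ drop-there , there q)

∈⊕ˡ : {A B : Subset n} {x : Fin n} → x ∈ A → x ∉ B → x ∈ A ⊕ B
∈⊕ˡ {B = true ∷ B}  here x∉B = contradiction here x∉B
∈⊕ˡ {B = false ∷ B} here x∉B = here
∈⊕ˡ {B = b ∷ B} (there p) x∉B = there (∈⊕ˡ p (x∉B ∘ there))

∈⊕⇒⊎ : {A B : Subset n} {x : Fin n} → x ∈ A ⊕ B → x ∈ A ⊎ x ∈ B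
∈⊕⇒⊎ p with ∈⊕⁻ p
... | inj₁ (q , _) = inj₁ q
... | inj₂ (_ , q) = inj₂ q

-- A common element of `A` and `B` contributes twice on the right, hence nothing.
sumOver-⊕ : (v : Fin n → Vec Bool r) (A B : Subset n) →
            sumOver v (A ⊕ B) ≡ sumOver v A ⊕ sumOver v B
sumOver-⊕ v [] [] = sym (⊕-identityˡ zeroVec)
sumOver-⊕ v (false ∷ A) (false ∷ B) = sumOver-⊕ (v ∘ suc) A B
sumOver-⊕ v (true ∷ A) (false ∷ B) =
  trans (cong (v zero ⊕_) (sumOver-⊕ (v ∘ suc) A B)) (sym (⊕-assoc (v zero) _ _))
sumOver-⊕ v (false ∷ A) (true ∷ B) =
  trans (cong (v zero ⊕_) (sumOver-⊕ (v ∘ suc) A B)) (⊕-leftComm (v zero) _ _)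
sumOver-⊕ v (true ∷ A) (true ∷ B) =
  trans (sumOver-⊕ (v ∘ suc) A B)
    (trans (sym (⊕-identityˡ _))
      (trans (cong (_⊕ (sumOver (v ∘ suc) A ⊕ sumOver (v ∘ suc) B)) (sym (⊕-self (v zero))))
        (⊕-interchange (v zero) (v zero) _ _)))

sumOver-∅ : (v : Fin n → Vec Bool r) → sumOver v ∅ ≡ zeroVec
sumOver-∅ {zero}  v = refl
sumOver-∅ {suc n} v = sumOver-∅ (v ∘ suc)

sumOver-⁅⁆ : (v : Fin n → Vec Bool r) (e : Fin n) → sumOver v ⁅ e ⁆ ≡ v e
sumOver-⁅⁆ v zero    = trans (cong (v zero ⊕_) (sumOver-∅ (v ∘ suc))) (⊕-identityʳ _)
sumOver-⁅⁆ v (suc e) = sumOver-⁅⁆ (v ∘ suc) e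

sumOver-toggle : (v : Fin n → Vec Bool r) (A : Subset n) (e : Fin n) →
                 sumOver v (⁅ e ⁆ ⊕ A) ≡ v e ⊕ sumOver v A
sumOver-toggle v A e = trans (sumOver-⊕ v ⁅ e ⁆ A) (cong (_⊕ _) (sumOver-⁅⁆ v e))

_·_ : Bool → Vec Bool r → Vec Bool r
b · u = if b then u else zeroVec

sumOver-remove : (v : Fin n → Vec Bool r) (A : Subset n) (e : Fin n) →
                 sumOver v A ≡ lookup A e · v e ⊕ sumOver v (A - e)
sumOver-remove v (true ∷ A)  zero = cong (λ B → v zero ⊕ sumOver (v ∘ suc) B) (sym (p─⊥≡p A))
sumOver-remove v (false ∷ A) zero =
  trans (cong (sumOver (v ∘ suc)) (sym (p─⊥≡p A))) (sym (⊕-identityˡ _))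
sumOver-remove v (true ∷ A)  (suc e) =
  trans (cong (v zero ⊕_) (sumOver-remove (v ∘ suc) A e)) (⊕-leftComm (v zero) _ _)
sumOver-remove v (false ∷ A) (suc e) = sumOver-remove (v ∘ suc) A e

sumOver-empty : (v : Fin n → Vec Bool r) {A : Subset n} → Empty A → sumOver v A ≡ zeroVec
sumOver-empty v empty = trans (cong (sumOver v) (Empty-unique empty)) (sumOver-∅ v)

-- Linear spans

infixr 5 _∷_
-- A list of generators is enough, as the only nonzero scalar is 1 and repetitions cancel. The
-- generators are given by a predicate, so that conditions such as being different from `e` need not
-- be turned into subsets.
data Span (v : Fin n → Vec Bool r) (P : Fin n → Set) : Vec Bool r → Set where
  []  : Span v P zeroVec
  _∷_ : ∀ {e u} → P e → Span v P u → Span v P (v e ⊕ u)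

Independent : (Fin n → Vec Bool r) → Subset n → Set
Independent v Y = ∀ Z → Z ⊆ Y → Nonempty Z → sumOver v Z ≢ zeroVec

module _ {v : Fin n → Vec Bool r} where
  private variable
    P Q R : Fin n → Set
    u w : Vec Bool r

  span-map : (∀ {x} → P x → Q x) → Span v P u → Span v Q u
  span-map f []      = []
  span-map f (p ∷ s) = f p ∷ span-map f s

  span-gen : ∀ {e} → P e → Span v P (v e)
  span-gen {P = P} {e} p = subst (Span v P) (⊕-identityʳ (v e)) (p ∷ [])

  span-⊕ : Span v P u → Span v P w → Span v P (u ⊕ w)
  span-⊕ {P = P} {w = w} [] t = subst (Span v P) (sym (⊕-identityˡ w)) t
  span-⊕ {P = P} {w = w} (_∷_ {e} {u} p s) t =
    subst (Span v P) (sym (⊕-assoc (v e) u w)) (p ∷ span-⊕ s t)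

  span-bind : (∀ {x} → P x → Span v Q (v x)) → Span v P u → Span v Q u
  span-bind f []      = []
  span-bind f (p ∷ s) = span-⊕ (f p) (span-bind f s)

  span-cancel : Span v P u → Span v P (u ⊕ w) → Span v P w
  span-cancel {P = P} {u} {w} s t = subst (Span v P) (⊕-cancel u w) (span-⊕ s t)

  span-cancelʳ : Span v P w → Span v P (u ⊕ w) → Span v P u
  span-cancelʳ {P = P} {w} {u} s t = span-cancel s (subst (Span v P) (⊕-comm u w) t)

  -- Each generator goes to the side chosen by `f`. Those on the `R` side are toggled in a set,
  -- since a repeated one cancels; the others stay in the span. This turns a dependence over `F ∪ T`
  -- into a subset of `T` modulo `F`.
  span-split : (∀ {x} → P x → Q x ⊎ R x) → Span v P u →
               ∃[ A ] (∀ {x} → x ∈ A → R x) × Span v Q (sumOver v A ⊕ u)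
  span-split {Q = Q} f [] =
    ∅ , (λ x∈ → contradiction x∈ ∉⊥) ,
    subst (Span v Q) (sym (trans (⊕-identityʳ _) (sumOver-∅ v))) []
  span-split {Q = Q} f (_∷_ {e} {u} p s) with span-split f s | f p
  ... | A , A⊆R , t | inj₁ q = A , A⊆R , subst (Span v Q) (⊕-leftComm (v e) _ u) (q ∷ t)
  ... | A , A⊆R , t | inj₂ re =
    ⁅ e ⁆ ⊕ A ,
    (λ x∈ → [ (λ x∈e → subst _ (sym (x∈⁅y⁆⇒x≡y e x∈e)) re) , A⊆R ]′ (∈⊕⇒⊎ x∈)) ,
    subst (Span v Q) (begin
      sumOver v A ⊕ u                      ≡⟨ ⊕-cancel (v e) _ ⟨
      v e ⊕ (v e ⊕ (sumOver v A ⊕ u))      ≡⟨ ⊕-leftComm (v e) (v e) _ ⟩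
      v e ⊕ (v e ⊕ (sumOver v A ⊕ u))      ≡⟨ ⊕-assoc (v e) (v e) _ ⟨
      (v e ⊕ v e) ⊕ (sumOver v A ⊕ u)      ≡⟨ ⊕-interchange (v e) (v e) _ u ⟩
      (v e ⊕ sumOver v A) ⊕ (v e ⊕ u)      ≡⟨ cong (_⊕ _) (sumOver-toggle v A e) ⟨
      sumOver v (⁅ e ⁆ ⊕ A) ⊕ (v e ⊕ u)    ∎) t
    where open ≡-Reasoning

  span-none : (∀ {x} → ¬ P x) → Span v P u → u ≡ zeroVec
  span-none ¬p []      = refl
  span-none ¬p (p ∷ _) = contradiction p ¬p

  span⇒sum : Span v P u → ∃[ A ] (∀ {x} → x ∈ A → P x) × sumOver v A ≡ u
  span⇒sum s with span-split inj₂ s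
  ... | A , A⊆P , t = A , A⊆P , ⊕≡0⇒≡ (span-none {P = λ _ → ⊥} (λ ()) t)

  -- The coefficient of `e` is 0 or 1.
  span-insert : ∀ {e} → Span v (λ x → P x ⊎ x ≡ e) u → Span v P u ⊎ Span v P (v e ⊕ u)
  span-insert [] = inj₁ []
  span-insert {P = P} {e = e} (_∷_ {e′} {u} (inj₁ p) s) with span-insert s
  ... | inj₁ t = inj₁ (p ∷ t)
  ... | inj₂ t = inj₂ (subst (Span v P) (⊕-leftComm (v e′) (v e) u) (p ∷ t))
  span-insert {P = P} (_∷_ {e} {u} (inj₂ refl) s) with span-insert s
  ... | inj₁ t = inj₂ (subst (Span v P) (sym (⊕-cancel (v e) u)) t)
  ... | inj₂ t = inj₁ t

span-∘ : {v : Fin n → Vec Bool r} {f : Fin m → Fin n} {P : Fin m → Set} {Q : Fin n → Set} {u : Vec Bool r} →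
         (∀ {x} → P x → Q (f x)) → Span (v ∘ f) P u → Span v Q u
span-∘ h []      = []
span-∘ h (p ∷ s) = h p ∷ span-∘ h s

sum∈span : (v : Fin n → Vec Bool r) (A : Subset n) → Span v (_∈ A) (sumOver v A)
sum∈span v []          = []
sum∈span v (true ∷ A)  = here ∷ span-∘ there (sum∈span (v ∘ suc) A)
sum∈span v (false ∷ A) = span-∘ there (sum∈span (v ∘ suc) A)

sum∈span′ : {v : Fin n → Vec Bool r} {P : Fin n → Set} {A : Subset n} →
            (∀ {x} → x ∈ A → P x) → Span v P (sumOver v A)
sum∈span′ {v = v} {A = A} f = span-map f (sum∈span v A)

_≟ᵛ_ : (u w : Vec Bool r) → Dec (u ≡ w)
_≟ᵛ_ = Vec.≡-dec Bool._≟_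

-- Deciding spans by a search through subsets is what makes the later arguments by contradiction
-- constructive.
span? : (v : Fin n → Vec Bool r) (X : Subset n) (u : Vec Bool r) → Dec (Span v (_∈ X) u)
span? v X u = map′ to from (anySubset? (λ A → A ⊆? X ×-dec sumOver v A ≟ᵛ u))
  where
  to : (∃[ A ] A ⊆ X × sumOver v A ≡ u) → Span v (_∈ X) u
  to (A , A⊆X , eq) = subst (Span v (_∈ X)) eq (sum∈span′ A⊆X)
  from : Span v (_∈ X) u → ∃[ A ] A ⊆ X × sumOver v A ≡ u
  from s = let A , A⊆X , eq = span⇒sum s in A , A⊆X , eq

-- Rank over F₂

∈-allSubsets : (X : Subset n) → X ∈ˡ allSubsets n
∈-allSubsets []          = here refl
∈-allSubsets (true ∷ X)  = ∈-++⁺ˡ (∈-map⁺ (true ∷_) (∈-allSubsets X))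
∈-allSubsets (false ∷ X) = ∈-++⁺ʳ _ (∈-map⁺ (false ∷_) (∈-allSubsets X))

⊆ᵇ-reflects : (X Y : Subset n) → Reflects (X ⊆ Y) (X ⊆ᵇ Y)
⊆ᵇ-reflects [] [] = ofʸ (λ ())
⊆ᵇ-reflects (false ∷ X) (y ∷ Y) with X ⊆ᵇ Y | ⊆ᵇ-reflects X Y
... | true  | ofʸ p = ofʸ (out⊆ p)
... | false | ofⁿ p = ofⁿ (p ∘ drop-∷-⊆)
⊆ᵇ-reflects (true ∷ X) (true ∷ Y) with X ⊆ᵇ Y | ⊆ᵇ-reflects X Y
... | true  | ofʸ p = ofʸ (in⊆in p)
... | false | ofⁿ p = ofⁿ (p ∘ drop-∷-⊆)
⊆ᵇ-reflects (true ∷ X) (false ∷ Y) = ofⁿ (λ p → contradiction (p here) λ ())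

nonEmptyᵇ-reflects : (X : Subset n) → Reflects (Nonempty X) (nonEmptyᵇ X)
nonEmptyᵇ-reflects [] = ofⁿ (λ ())
nonEmptyᵇ-reflects (true ∷ X) = ofʸ (zero , here)
nonEmptyᵇ-reflects (false ∷ X) with nonEmptyᵇ X | nonEmptyᵇ-reflects X
... | true  | ofʸ (x , p) = ofʸ (suc x , there p)
... | false | ofⁿ p = ofⁿ λ { (suc x , there q) → p (x , q) }

isZeroᵇ-reflects : (u : Vec Bool r) → Reflects (u ≡ zeroVec) (isZeroᵇ u)
isZeroᵇ-reflects [] = ofʸ refl
isZeroᵇ-reflects (true ∷ u) = ofⁿ λ ()
isZeroᵇ-reflects (false ∷ u) with isZeroᵇ u | isZeroᵇ-reflects u
... | true  | ofʸ p = ofʸ (cong (false ∷_) p)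
... | false | ofⁿ p = ofⁿ (p ∘ Vec.∷-injectiveʳ)

module _ {A : Set} (f : A → Bool) where
  all-true⁻ : ∀ {a} xs → a ∈ˡ xs → foldr (λ x b → f x ∧ b) true xs ≡ true → f a ≡ true
  all-true⁻ (x ∷ xs) (here refl) eq with f x
  ... | true = refl
  all-true⁻ (x ∷ xs) (there p) eq with f x
  ... | true = all-true⁻ xs p eq

  all-true⁺ : ∀ xs → (∀ a → f a ≡ true) → foldr (λ x b → f x ∧ b) true xs ≡ true
  all-true⁺ []       h = refl
  all-true⁺ (x ∷ xs) h = cong₂ _∧_ (h x) (all-true⁺ xs h)

module _ {A : Set} (f : A → ℕ) where
  maximum : List A → ℕ
  maximum = foldr (λ x k → f x ⊔ k) 0

  ≤-maximum : ∀ {a} xs → a ∈ˡ xs → f a ≤ maximum xs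
  ≤-maximum (x ∷ xs) (here refl) = ℕ.m≤m⊔n _ _
  ≤-maximum (x ∷ xs) (there p)   = ℕ.≤-trans (≤-maximum xs p) (ℕ.m≤n⊔m (f x) _)

  maximum-attained : ∀ xs → maximum xs ≡ 0 ⊎ ∃[ a ] f a ≡ maximum xs
  maximum-attained [] = inj₁ refl
  maximum-attained (x ∷ xs) with ℕ.⊔-sel (f x) (maximum xs)
  ... | inj₁ eq = inj₂ (x , sym eq)
  ... | inj₂ eq with maximum-attained xs
  ...   | inj₁ eq₀      = inj₁ (trans eq eq₀)
  ...   | inj₂ (a , eq₁) = inj₂ (a , trans eq₁ (sym eq))

module _ (v : Fin n → Vec Bool r) where
  private
    dependent-test : ∀ Y Z → Reflects (¬ (Z ⊆ Y × Nonempty Z) ⊎ ¬ (sumOver v Z ≡ zeroVec))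
                     (not (Z ⊆ᵇ Y ∧ nonEmptyᵇ Z) ∨ not (isZeroᵇ (sumOver v Z)))
    dependent-test Y Z = ¬-reflects (⊆ᵇ-reflects Z Y ×-reflects nonEmptyᵇ-reflects Z)
                         ⊎-reflects ¬-reflects (isZeroᵇ-reflects (sumOver v Z))

  independentᵇ-sound : ∀ {Y} → independentᵇ v Y ≡ true → Independent v Y
  independentᵇ-sound {Y} eq Z Z⊆Y ne sum≡0
    with invert (subst (Reflects _) (all-true⁻ _ (allSubsets n) (∈-allSubsets Z) eq) (dependent-test Y Z))
  ... | inj₁ ¬p = ¬p (Z⊆Y , ne)
  ... | inj₂ ¬p = ¬p sum≡0

  independentᵇ-complete : ∀ {Y} → Independent v Y → independentᵇ v Y ≡ true
  independentᵇ-complete {Y} ind = all-true⁺ _ (allSubsets n) λ Z → reflects-true (dependent-test Y Z) (holds Z)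
    where
    reflects-true : ∀ {A : Set} {b} → Reflects A b → A → b ≡ true
    reflects-true (ofʸ _)  a = refl
    reflects-true (ofⁿ ¬a) a = contradiction a ¬a
    holds : ∀ Z → ¬ (Z ⊆ Y × Nonempty Z) ⊎ ¬ (sumOver v Z ≡ zeroVec)
    holds Z with Z ⊆? Y ×-dec nonempty? Z
    ... | yes (p , q) = inj₂ (ind Z p q)
    ... | no ¬p       = inj₁ ¬p

  -- The two properties of a largest independent subset from which everything about rank is derived.
  -- Being stated for any `ρ`, they apply to `rankF2`, to the rank of `M` and to the dual rank
  -- alike.
  record IsRank (ρ : Subset n → ℕ) : Set where
    field
      basis : ∀ X → ∃[ Y ] Y ⊆ X × Independent v Y × ∣ Y ∣ ≡ ρ X
      bound : ∀ {X Y} → Y ⊆ X → Independent v Y → ∣ Y ∣ ≤ ρ X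

  ∅-independent : Independent v ∅
  ∅-independent Z Z⊆∅ (x , x∈Z) _ = ∉⊥ (Z⊆∅ x∈Z)

  rankF2-isRank : IsRank (rankF2 v)
  rankF2-isRank = record { basis = basis ; bound = bound }
    where
    size : Subset n → Subset n → ℕ
    size X Y = if (Y ⊆ᵇ X) ∧ independentᵇ v Y then ∣ Y ∣ else 0

    -- The maximum may be the initial 0, or the default 0 of a set that fails the test; the empty
    -- set then serves as basis.
    basis₀ : ∀ X → 0 ≡ rankF2 v X → ∃[ Y ] Y ⊆ X × Independent v Y × ∣ Y ∣ ≡ rankF2 v X
    basis₀ X eq = ∅ , ⊥⊆ , ∅-independent , trans (∣⊥∣≡0 n) eq

    basis : ∀ X → ∃[ Y ] Y ⊆ X × Independent v Y × ∣ Y ∣ ≡ rankF2 v X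
    basis X with maximum-attained (size X) (allSubsets n)
    ... | inj₁ eq = basis₀ X (sym eq)
    ... | inj₂ (Y , eq) with Y ⊆ᵇ X | ⊆ᵇ-reflects Y X | independentᵇ v Y in ind
    ...   | true  | ofʸ Y⊆X | true  = Y , Y⊆X , independentᵇ-sound ind , eq
    ...   | true  | _       | false = basis₀ X eq
    ...   | false | _       | _     = basis₀ X eq

    bound : ∀ {X Y} → Y ⊆ X → Independent v Y → ∣ Y ∣ ≤ rankF2 v X
    bound {X} {Y} Y⊆X ind = subst (_≤ rankF2 v X) size≡ (≤-maximum (size X) (allSubsets n) (∈-allSubsets Y))
      where
      size≡ : size X Y ≡ ∣ Y ∣
      size≡ with Y ⊆ᵇ X | ⊆ᵇ-reflects Y X
      ... | true  | _      = cong (if_then ∣ Y ∣ else 0) (independentᵇ-complete ind)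
      ... | false | ofⁿ ¬p = contradiction (λ {x} → Y⊆X {x}) ¬p


∣p∣≡1+∣p-x∣ : {p : Subset n} {x : Fin n} → x ∈ p → ∣ p ∣ ≡ suc ∣ p - x ∣
∣p∣≡1+∣p-x∣ {p = true ∷ p}  here      = cong (suc ∘ ∣_∣) (sym (p─⊥≡p p))
∣p∣≡1+∣p-x∣ {p = true ∷ p}  (there h) = cong suc (∣p∣≡1+∣p-x∣ h)
∣p∣≡1+∣p-x∣ {p = false ∷ p} (there h) = ∣p∣≡1+∣p-x∣ h

x∈p-y⁻ : {p : Subset n} {x y : Fin n} → x ∈ p - y → x ∈ p × x ≢ y
x∈p-y⁻ {p = p} {y = y} x∈ =
  p─q⊆p p ⁅ y ⁆ x∈ , λ { refl → contradiction x∈ (y∉p-y p y) }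
  where
  y∉p-y : ∀ {n} (p : Subset n) y → y ∉ p - y
  y∉p-y (x ∷ p) (suc y) (there h) = y∉p-y p y h

p-x∪x≡p : {p : Subset n} {x : Fin n} → x ∈ p → (p - x) ∪ ⁅ x ⁆ ≡ p
p-x∪x≡p {p = p} {x} x∈p = ⊆-antisym
  (λ y∈ → [ proj₁ ∘ x∈p-y⁻ , (λ y∈x → subst (_∈ p) (sym (x∈⁅y⁆⇒x≡y x y∈x)) x∈p) ]′ (x∈p∪q⁻ _ _ y∈))
  λ {y} y∈p → x∈p∪q⁺ (aux y y∈p)
  where
  aux : ∀ y → y ∈ p → y ∈ p - x ⊎ y ∈ ⁅ x ⁆
  aux y y∈p with y Fin.≟ x
  ... | yes refl = inj₂ (x∈⁅x⁆ x)
  ... | no y≢x   = inj₁ (x∈p∧x≢y⇒x∈p-y y∈p y≢x)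

module Rank {v : Fin n → Vec Bool r} {ρ : Subset n → ℕ} (R : IsRank v ρ) where
  open IsRank R

  -- A zero sum without `e` lies in `Y`; taking `e` out of one that contains it writes `v e` as a
  -- sum over `Y`.
  independent-insert : ∀ {Y e} → Independent v Y → ¬ Span v (_∈ Y) (v e) → Independent v (Y ∪ ⁅ e ⁆)
  independent-insert {Y} {e} ind ¬s Z Z⊆ ne sum≡0 with e ∈? Z
  ... | no e∉Z = ind Z Z⊆Y ne sum≡0
    where
    Z⊆Y : Z ⊆ Y
    Z⊆Y x∈Z with x∈p∪q⁻ Y ⁅ e ⁆ (Z⊆ x∈Z)
    ... | inj₁ p = p
    ... | inj₂ p = contradiction (subst (_∈ Z) (x∈⁅y⁆⇒x≡y e p) x∈Z) e∉Z
  ... | yes e∈Z = ¬s (subst (Span v (_∈ Y)) eq (sum∈span′ sub))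
    where
    sub : ∀ {x} → x ∈ ⁅ e ⁆ ⊕ Z → x ∈ Y
    sub x∈ with ∈⊕⁻ x∈
    ... | inj₁ (p , x∉Z) = contradiction (subst (_∈ Z) (sym (x∈⁅y⁆⇒x≡y e p)) e∈Z) x∉Z
    ... | inj₂ (x∉e , x∈Z) = [ id , (λ p → contradiction p x∉e) ]′ (x∈p∪q⁻ Y ⁅ e ⁆ (Z⊆ x∈Z))
    eq : sumOver v (⁅ e ⁆ ⊕ Z) ≡ v e
    eq = trans (sumOver-toggle v Z e) (trans (cong (v e ⊕_) sum≡0) (⊕-identityʳ _))

  -- Otherwise adding `e` would give an independent subset of `X` with more than `ρ X` elements.
  maximal-spans : ∀ {X Y e} → Y ∪ ⁅ e ⁆ ⊆ X → Independent v Y → ρ X ≤ ∣ Y ∣ → Span v (_∈ Y) (v e)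
  maximal-spans {X} {Y} {e} sub ind ρ≤ = decidable-stable (span? v Y (v e)) λ ¬s →
    ℕ.<⇒≱ (p⊂q⇒∣p∣<∣q∣ (p⊆p∪q ⁅ e ⁆ , e , q⊆p∪q Y ⁅ e ⁆ (x∈⁅x⁆ e) , ¬s ∘ span-gen))
      (ℕ.≤-trans (bound sub (independent-insert ind ¬s)) ρ≤)

  rank-mono : ∀ {X Y} → X ⊆ Y → ρ X ≤ ρ Y
  rank-mono {X} {Y} X⊆Y with I , I⊆X , ind , eq ← basis X =
    subst (_≤ ρ Y) eq (bound (λ x∈ → X⊆Y (I⊆X x∈)) ind)

  rank≤size : ∀ X → ρ X ≤ ∣ X ∣
  rank≤size X with I , I⊆X , ind , eq ← basis X = subst (_≤ ∣ X ∣) eq (p⊆q⇒∣p∣≤∣q∣ I⊆X)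

  rank⇒span : ∀ {X e} → ρ (X ∪ ⁅ e ⁆) ≤ ρ X → Span v (_∈ X) (v e)
  rank⇒span {X} {e} ρ≤ with I , I⊆X , ind , eq ← basis X =
    span-map I⊆X (maximal-spans
      (λ x∈ → [ (λ p → p⊆p∪q ⁅ e ⁆ (I⊆X p)) , q⊆p∪q X ⁅ e ⁆ ]′ (x∈p∪q⁻ I ⁅ e ⁆ x∈))
      ind (ℕ.≤-trans ρ≤ (ℕ.≤-reflexive (sym eq))))

  -- If the rank grew, a basis `I` of `X ∪ ⁅ e ⁆` would contain `e`, being too large for an
  -- independent subset of `X`. Then `I - e` still has `ρ X` elements, so it spans `X` and with it
  -- `v e`, and `I` would be dependent.
  span⇒rank : ∀ {X e} → Span v (_∈ X) (v e) → ρ (X ∪ ⁅ e ⁆) ≤ ρ X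
  span⇒rank {X} {e} s with I , I⊆ , ind , eq ← basis (X ∪ ⁅ e ⁆) | ρ (X ∪ ⁅ e ⁆) ≤? ρ X
  ... | yes ρ≤ = ρ≤
  ... | no ρ≰ = contradiction eI≡0 (ind eI eI⊆I (e , ∈⊕ˡ (x∈⁅x⁆ e) e∉A))
    where
    drop-e : ∀ {x} → x ∈ I → x ≢ e → x ∈ X
    drop-e x∈I x≢e = [ id , (λ p → contradiction (x∈⁅y⁆⇒x≡y e p) x≢e) ]′ (x∈p∪q⁻ X ⁅ e ⁆ (I⊆ x∈I))
    e∈I : e ∈ I
    e∈I = decidable-stable (e ∈? I) λ e∉I → ρ≰ (subst (_≤ ρ X) eq
      (bound (λ x∈I → drop-e x∈I λ { refl → e∉I x∈I }) ind))
    small : ρ X ≤ ∣ I - e ∣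
    small = s≤s⁻¹ (ℕ.≤-trans (ℕ.≰⇒> ρ≰) (ℕ.≤-reflexive (trans (sym eq) (∣p∣≡1+∣p-x∣ e∈I))))
    I-e⊆X : ∀ {x} → x ∈ I - e → x ∈ X
    I-e⊆X x∈ = let x∈I , x≢e = x∈p-y⁻ x∈ in drop-e x∈I x≢e
    I-e-independent : Independent v (I - e)
    I-e-independent Z Z⊆ = ind Z (λ x∈ → proj₁ (x∈p-y⁻ (Z⊆ x∈)))
    spanned : Span v (_∈ I - e) (v e)
    spanned = span-bind (λ {x} x∈X → maximal-spans
      (λ y∈ → [ I-e⊆X , (λ p → subst (_∈ X) (sym (x∈⁅y⁆⇒x≡y x p)) x∈X) ]′ (x∈p∪q⁻ _ _ y∈))
      I-e-independent small) s
    A = proj₁ (span⇒sum spanned)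
    A⊆ : ∀ {x} → x ∈ A → x ∈ I - e
    A⊆ = proj₁ (proj₂ (span⇒sum spanned))
    e∉A : e ∉ A
    e∉A e∈A = proj₂ (x∈p-y⁻ (A⊆ e∈A)) refl
    eI = ⁅ e ⁆ ⊕ A
    eI⊆I : eI ⊆ I
    eI⊆I x∈ = [ (λ p → subst (_∈ I) (sym (x∈⁅y⁆⇒x≡y e p)) e∈I) , (λ p → proj₁ (x∈p-y⁻ (A⊆ p))) ]′ (∈⊕⇒⊎ x∈)
    eI≡0 : sumOver v eI ≡ zeroVec
    eI≡0 = trans (sumOver-toggle v A e) (≡⇒⊕≡0 (sym (proj₂ (proj₂ (span⇒sum spanned)))))

  -- The set without `s` and `t` is independent and spans both, so it is a basis that leaves out two
  -- elements.
  nullity-two : ∀ {s t} → s ≢ t → Span v (λ x → x ≢ s × x ≢ t) (v s) → Span v (λ x → x ≢ s × x ≢ t) (v t) →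
                Independent v ((⊤ - s) - t) → ∣ ⊤ {n} ∣ ∸ ρ ⊤ ≡ 2
  nullity-two {s} {t} s≢t span-s span-t ind = trans (cong₂ _∸_ size rank) (ℕ.m+n∸n≡m 2 ∣ B ∣)
    where
    B = (⊤ - s) - t
    t∈ : t ∈ ⊤ - s
    t∈ = x∈p∧x≢y⇒x∈p-y ∈⊤ (s≢t ∘ sym)
    to-B : ∀ {x} → x ≢ s × x ≢ t → x ∈ B
    to-B (x≢s , x≢t) = x∈p∧x≢y⇒x∈p-y (x∈p∧x≢y⇒x∈p-y ∈⊤ x≢s) x≢t
    size : ∣ ⊤ {n} ∣ ≡ suc (suc ∣ B ∣)
    size = trans (∣p∣≡1+∣p-x∣ {x = s} ∈⊤) (cong suc (∣p∣≡1+∣p-x∣ t∈))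
    rank : ρ ⊤ ≡ ∣ B ∣
    rank = ℕ.≤-antisym
      (subst (_≤ ∣ B ∣) (cong ρ (p-x∪x≡p {x = s} ∈⊤))
        (ℕ.≤-trans (span⇒rank {⊤ - s} {s} (span-map (λ p → p─q⊆p _ ⁅ t ⁆ (to-B p)) span-s))
          (subst (_≤ ∣ B ∣) (cong ρ (p-x∪x≡p t∈))
            (ℕ.≤-trans (span⇒rank {B} {t} (span-map to-B span-t)) (rank≤size B)))))
      (bound ⊆⊤ ind)

-- Cyclic flats of a vector configuration

module Configuration (v : Fin n → Vec Bool r) where

  IsFlat : Subset n → Set
  IsFlat X = ∀ {e} → Span v (_∈ X) (v e) → e ∈ X

  IsCyclic : Subset n → Set
  IsCyclic X = ∀ {e} → e ∈ X → Span v (λ x → x ∈ X × x ≢ e) (v e)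

  cl : Subset n → Subset n
  cl X = tabulate (λ e → does (span? v X (v e)))

  ∈cl⁺ : ∀ {X e} → Span v (_∈ X) (v e) → e ∈ cl X
  ∈cl⁺ {X} {e} s = Vec.lookup⇒[]= e (cl X) (trans (Vec.lookup∘tabulate _ e) (dec-true (span? v X (v e)) s))

  ∈cl⁻ : ∀ {X e} → e ∈ cl X → Span v (_∈ X) (v e)
  ∈cl⁻ {X} {e} e∈ with span? v X (v e) in eq
  ... | yes s = s
  ... | no ¬s = contradiction (trans (sym (Vec.[]=⇒lookup e∈)) (trans (Vec.lookup∘tabulate _ e) (cong does eq))) λ ()

  cl-extensive : ∀ {X e} → e ∈ X → e ∈ cl X
  cl-extensive = ∈cl⁺ ∘ span-gen

  cl-isFlat : ∀ X → IsFlat (cl X)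
  cl-isFlat X s = ∈cl⁺ (span-bind ∈cl⁻ s)

  -- A cycle of the contraction by F.
  RelCycle : Subset n → Subset n → Set
  RelCycle F T = Nonempty T × (∀ t → t ∈ T → t ∉ F) × Span v (_∈ F) (sumOver v T)

  RelCircuit : Subset n → Subset n → Set
  RelCircuit F T = RelCycle F T × (∀ {S} → S ⊆ T → RelCycle F S → T ⊆ S)

  relCycle? : ∀ F T → Dec (RelCycle F T)
  relCycle? F T = nonempty? T ×-dec Fin.all? (λ t → t ∈? T →-dec ¬? (t ∈? F)) ×-dec span? v F (sumOver v T)

  relCircuit-below : ∀ {F T} → RelCycle F T → ∃[ S ] S ⊆ T × RelCircuit F S
  relCircuit-below {F} {T} = go T (<-wellFounded _)
    where
    go : ∀ T → Acc _<_ ∣ T ∣ → RelCycle F T → ∃[ S ] S ⊆ T × RelCircuit F S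
    go T (acc rec) c with anySubset? (λ S → S ⊂? T ×-dec relCycle? F S)
    ... | yes (S , S⊂T , d) with U , U⊆S , e ← go S (rec (p⊂q⇒∣p∣<∣q∣ S⊂T)) d =
      U , (λ x∈ → proj₁ S⊂T (U⊆S x∈)) , e
    ... | no ¬smaller = T , id , c , λ {S} S⊆T d {x} x∈T →
      decidable-stable (x ∈? S) λ x∉S → ¬smaller (S , (S⊆T , x , x∈T , x∉S) , d)

  -- Source of the cyclic flats in all chain arguments. An element of `F` is spanned by the rest of
  -- `F`, an element of `T` by solving the relation of the cycle for it, and any other element by
  -- `F ∪ T`, which does not contain it.
  cl-isCyclic : ∀ {F T} → IsCyclic F → RelCycle F T → IsCyclic (cl (F ∪ T))
  cl-isCyclic {F} {T} F-cyc (_ , disj , s) {e} e∈ with e ∈? F | e ∈? T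
  ... | yes e∈F | _ = span-map (λ (p , q) → cl-extensive (x∈p∪q⁺ (inj₁ p)) , q) (F-cyc e∈F)
  ... | no e∉F | yes e∈T = span-cancelʳ
      (span-map (λ p → cl-extensive (x∈p∪q⁺ (inj₁ p)) , λ { refl → e∉F p }) s)
      (subst (Span v _) (sumOver-toggle v T e) (sum∈span′ in-T))
    where
    in-T : ∀ {x} → x ∈ ⁅ e ⁆ ⊕ T → x ∈ cl (F ∪ T) × x ≢ e
    in-T x∈ with ∈⊕⁻ x∈
    ... | inj₁ (p , x∉T) = contradiction (subst (_∈ T) (sym (x∈⁅y⁆⇒x≡y e p)) e∈T) x∉T
    ... | inj₂ (x∉e , x∈T) = cl-extensive (x∈p∪q⁺ (inj₂ x∈T)) , λ { refl → x∉e (x∈⁅x⁆ e) }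
  ... | no e∉F | no e∉T = span-map
      (λ p → cl-extensive p , λ { refl → [ e∉F , e∉T ]′ (x∈p∪q⁻ F T p) }) (∈cl⁻ e∈)

  relCycle-insert : ∀ {F A g} → (∀ {x} → x ∈ A → x ∉ F) → g ∉ F → g ∉ A →
                    Span v (_∈ F) (sumOver v A ⊕ v g) → RelCycle F (⁅ g ⁆ ⊕ A)
  relCycle-insert {F} {A} {g} disj g∉F g∉A s =
    (g , ∈⊕ˡ (x∈⁅x⁆ g) g∉A) ,
    (λ x x∈ → [ (λ p → subst (_∉ F) (sym (x∈⁅y⁆⇒x≡y g p)) g∉F) , disj ]′ (∈⊕⇒⊎ x∈)) ,
    subst (Span v (_∈ F)) (trans (⊕-comm _ (v g)) (sym (sumOver-toggle v A g))) s

  -- Modulo F, an element spanned by a circuit T and not on it is the sum of some A ⊂ T; the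
  -- hypothesis makes A span T, so that T has only one element more than A.
  parallel-mod : ∀ {F T g} → IsFlat F → RelCircuit F T →
    (∀ {S} → RelCycle F S → (∀ {x} → x ∈ S → Span v (_∈ F ∪ T) (v x)) → ∀ {t} → t ∈ T → Span v (_∈ F ∪ S) (v t)) →
    Span v (_∈ F ∪ T) (v g) → g ∉ F → g ∉ T →
    ∃[ t ] t ∈ T × Span v (_∈ F) (v g ⊕ v t)
  parallel-mod {F} {T} {g} F-flat ((_ , disj , sT) , minimal) spans s g∉F g∉T
    with A , A⊆T , sA ← span-split (x∈p∪q⁻ F T) s
    with Fin.any? (λ t → t ∈? T ×-dec ¬? (t ∈? A))
  ... | no none = contradiction (F-flat (span-cancel (subst (λ X → Span v (_∈ F) (sumOver v X)) T≡A sT) sA)) g∉F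
    where
    T≡A : T ≡ A
    T≡A = ⊆-antisym (λ {t} t∈T → decidable-stable (t ∈? A) λ t∉A → none (t , t∈T , t∉A)) A⊆T
  ... | yes (t , t∈T , t∉A) = t , t∈T , goal
    where
    S = ⁅ g ⁆ ⊕ A
    S-cycle : RelCycle F S
    S-cycle = relCycle-insert (λ x∈A → disj _ (A⊆T x∈A)) g∉F (g∉T ∘ A⊆T) sA
    S-spanned : ∀ {x} → x ∈ S → Span v (_∈ F ∪ T) (v x)
    S-spanned x∈ = [ (λ p → subst (Span v _ ∘ v) (sym (x∈⁅y⁆⇒x≡y g p)) s)
                   , (λ p → span-gen (x∈p∪q⁺ (inj₂ (A⊆T p)))) ]′ (∈⊕⇒⊎ x∈)
    g-spanned : Span v (λ x → x ∈ F ⊎ x ∈ A) (v g)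
    g-spanned = span-cancel (sum∈span′ inj₂) (span-map inj₁ sA)
    from-S : ∀ {x} → x ∈ F ∪ S → Span v (λ x → x ∈ F ⊎ x ∈ A) (v x)
    from-S x∈ with x∈p∪q⁻ F S x∈
    ... | inj₁ p = span-gen (inj₁ p)
    ... | inj₂ p with ∈⊕⇒⊎ p
    ...   | inj₁ q = subst (Span v _ ∘ v) (sym (x∈⁅y⁆⇒x≡y g q)) g-spanned
    ...   | inj₂ q = span-gen (inj₂ q)
    goal : Span v (_∈ F) (v g ⊕ v t)
    goal with B , B⊆A , sB ← span-split id (span-bind from-S (spans S-cycle S-spanned t∈T)) =
      subst (Span v (_∈ F)) (begin
        (sumOver v A ⊕ v g) ⊕ (sumOver v B ⊕ v t)  ≡⟨ cong (λ X → _ ⊕ (sumOver v X ⊕ v t)) B≡A ⟩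
        (sumOver v A ⊕ v g) ⊕ (sumOver v A ⊕ v t)  ≡⟨ ⊕-interchange _ (v g) _ (v t) ⟩
        (sumOver v A ⊕ sumOver v A) ⊕ (v g ⊕ v t)  ≡⟨ cong (_⊕ _) (⊕-self _) ⟩
        zeroVec ⊕ (v g ⊕ v t)                      ≡⟨ ⊕-identityˡ _ ⟩
        v g ⊕ v t                                  ∎) (span-⊕ sA sB)
      where
      open ≡-Reasoning
      tB-cycle : RelCycle F (⁅ t ⁆ ⊕ B)
      tB-cycle = relCycle-insert (λ x∈B → disj _ (A⊆T (B⊆A x∈B))) (disj t t∈T) (t∉A ∘ B⊆A) sB
      T⊆tB : T ⊆ ⁅ t ⁆ ⊕ B
      T⊆tB = minimal
        (λ x∈ → [ (λ p → subst (_∈ T) (sym (x∈⁅y⁆⇒x≡y t p)) t∈T) , (λ p → A⊆T (B⊆A p)) ]′ (∈⊕⇒⊎ x∈))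
        tB-cycle
      B≡A : B ≡ A
      B≡A = ⊆-antisym B⊆A λ x∈A →
        [ (λ p → contradiction (subst (_∈ A) (x∈⁅y⁆⇒x≡y t p) x∈A) t∉A) , id ]′ (∈⊕⇒⊎ (T⊆tB (A⊆T x∈A)))


-- Splitting subsets, sums along a list of elements, coordinates

partition : (X Y : Subset n) → X ≡ (X ∩ Y) ⊕ (X ─ Y)
partition [] [] = refl
partition (x ∷ X) (true ∷ Y)  = cong₂ _∷_ (bit x) (partition X Y)
  where
  bit : ∀ x → x ≡ (x ∧ true) xor false
  bit true  = refl
  bit false = refl
partition (x ∷ X) (false ∷ Y) = cong₂ _∷_ (bit x) (partition X Y)
  where
  bit : ∀ x → x ≡ (x ∧ false) xor x
  bit true  = refl
  bit false = refl

x∈p─q⇒x∉q : {p q : Subset n} {x : Fin n} → x ∈ p ─ q → x ∉ q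
x∈p─q⇒x∉q {p = _ ∷ p} {true ∷ q}  (there h) (there i) = x∈p─q⇒x∉q h i
x∈p─q⇒x∉q {p = _ ∷ p} {false ∷ q} (there h) (there i) = x∈p─q⇒x∉q h i

lookup-remove : (p : Subset n) {x y : Fin n} → x ≢ y → lookup (p - x) y ≡ lookup p y
lookup-remove (b ∷ p) {zero}  {zero}  x≢y = contradiction refl x≢y
lookup-remove (b ∷ p) {zero}  {suc y} x≢y = cong (λ q → lookup q y) (p─⊥≡p p)
lookup-remove (b ∷ p) {suc x} {zero}  x≢y = refl
lookup-remove (b ∷ p) {suc x} {suc y} x≢y = lookup-remove p (x≢y ∘ cong suc)

sumOver-∷ : (v : Fin (suc n) → Vec Bool r) (b : Bool) (A : Subset n) →
            sumOver v (b ∷ A) ≡ b · v zero ⊕ sumOver (v ∘ suc) A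
sumOver-∷ v true  A = refl
sumOver-∷ v false A = sym (⊕-identityˡ _)

-- Turns a sum over a subset of a small listed set into a bit vector of coordinates. In the
-- induction `x` is taken out of `S`; the remaining entries differ from `x`, so their bits do not
-- change.
sumOver-enumerate : (v : Fin n → Vec Bool r) {S : Subset n} (xs : Vec (Fin n) k) → Unique xs →
                    (∀ {x} → x ∈ S → x ∈ᵛ xs) →
                    sumOver v S ≡ sumOver (v ∘ lookup xs) (Vector.map (lookup S) xs)
sumOver-enumerate v [] _ cover = sumOver-empty v λ (x , x∈) → case (cover x∈)
  where
  case : ∀ {x} → ¬ (x ∈ᵛ [])
  case ()
sumOver-enumerate v {S} (x ∷ xs) (x∉ ∷ uniq) cover = begin
  sumOver v S                                              ≡⟨ sumOver-remove v S x ⟩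
  lookup S x · v x ⊕ sumOver v (S - x)                     ≡⟨ cong (_ ⊕_) (sumOver-enumerate v xs uniq cover′) ⟩
  lookup S x · v x ⊕ sumOver w (Vector.map (lookup (S - x)) xs)
    ≡⟨ cong (λ A → _ ⊕ sumOver w A) (same xs x∉) ⟩
  lookup S x · v x ⊕ sumOver w (Vector.map (lookup S) xs)  ≡⟨ sumOver-∷ (v ∘ lookup (x ∷ xs)) _ _ ⟨
  sumOver (v ∘ lookup (x ∷ xs)) (Vector.map (lookup S) (x ∷ xs)) ∎
  where
  open ≡-Reasoning
  w = v ∘ lookup xs
  cover′ : ∀ {y} → y ∈ S - x → y ∈ᵛ xs
  cover′ y∈ with x∈p-y⁻ y∈
  ... | y∈S , y≢x with cover y∈S
  ...   | here y≡x = contradiction y≡x y≢x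
  ...   | there p  = p
  same : ∀ {j} (ys : Vec (Fin _) j) → All (x ≢_) ys → Vector.map (lookup (S - x)) ys ≡ Vector.map (lookup S) ys
  same []       []       = refl
  same (y ∷ ys) (p ∷ ps) = cong₂ _∷_ (lookup-remove S p) (same ys ps)

sumOver-enumerate-all : (v : Fin n → Vec Bool r) {S : Subset n} (xs : Vec (Fin n) k) → Unique xs →
                        All (_∈ S) xs → (∀ {x} → x ∈ S → x ∈ᵛ xs) →
                        sumOver v S ≡ sumOver (v ∘ lookup xs) ⊤
sumOver-enumerate-all v {S} xs uniq sub cover =
  trans (sumOver-enumerate v xs uniq cover) (cong (sumOver (v ∘ lookup xs)) (all-in xs sub))
  where
  all-in : ∀ {j} (ys : Vec (Fin _) j) → All (_∈ S) ys → Vector.map (lookup S) ys ≡ ⊤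
  all-in []       []       = refl
  all-in (y ∷ ys) (p ∷ ps) = cong₂ _∷_ (Vec.[]=⇒lookup p) (all-in ys ps)

parity : Vec Bool k → Bool
parity = Vector.foldr _ _xor_ false

independent-∷ : (w : Fin (suc k) → Vec Bool r) → (∀ u → w zero ≢ sumOver (w ∘ suc) u) →
                Independent (w ∘ suc) ⊤ → Independent w ⊤
independent-∷ w w₀∉ ind (true ∷ Z)  _ _                    eq = w₀∉ Z (⊕≡0⇒≡ eq)
independent-∷ w w₀∉ ind (false ∷ Z) _ (suc x , there x∈Z) eq = ind Z (λ _ → ∈⊤) (x , x∈Z) eq

span⇒coordinates : {v : Fin n → Vec Bool r} {P : Fin n → Set} {y : Vec Bool r} (w : Fin k → Vec Bool r) →
                   (∀ {x} → P x → ∃[ u ] v x ≡ sumOver w u) → Span v P y → ∃[ u ] y ≡ sumOver w u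
span⇒coordinates w f [] = ∅ , sym (sumOver-∅ w)
span⇒coordinates w f (p ∷ s) with f p | span⇒coordinates w f s
... | a , eq | b , eq′ = a ⊕ b , trans (cong₂ _⊕_ eq eq′) (sym (sumOver-⊕ w a b))

-- Circuits of the configuration and the classification

module Classify (v : Fin n → Vec Bool r)
  (no-loop     : ∀ e → v e ≢ zeroVec)
  (no-parallel : ∀ {e f} → v e ≡ v f → e ≡ f)
  (no-isthmus  : ∀ e → Span v (_≢ e) (v e))
  -- Height 3 with the outer members of the chain left out; `g` witnesses that `Y` is proper. The
  -- last hypothesis denies that removing two elements can leave a basis.
  (no-chain    : ∀ {X Y g} → Configuration.IsFlat v X → Configuration.IsCyclic v X →
                 Configuration.IsFlat v Y → Configuration.IsCyclic v Y → Nonempty X → X ⊂ Y → g ∉ Y → ⊥)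
  (nullity≢2   : ∀ {s t} → s ≢ t → Span v (λ x → x ≢ s × x ≢ t) (v s) →
                 Span v (λ x → x ≢ s × x ≢ t) (v t) → Independent v ((⊤ - s) - t) → ⊥)
  where

  open Configuration v

  Circuit : Subset n → Set
  Circuit C = Nonempty C × sumOver v C ≡ zeroVec ×
              (∀ {D} → D ⊆ C → Nonempty D → sumOver v D ≡ zeroVec → C ⊆ D)

  ∅-isFlat : IsFlat ∅
  ∅-isFlat {e} s = contradiction (span-none ∉⊥ s) (no-loop e)

  ∅-isCyclic : IsCyclic ∅
  ∅-isCyclic e∈∅ = contradiction e∈∅ ∉⊥

  zero-sum⇒relCycle : ∀ {C} → Nonempty C → sumOver v C ≡ zeroVec → RelCycle ∅ C
  zero-sum⇒relCycle ne eq = ne , (λ _ _ → ∉⊥) , subst (Span v _) (sym eq) []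

  circuit⇒relCircuit : ∀ {C} → Circuit C → RelCircuit ∅ C
  circuit⇒relCircuit (ne , eq , minimal) =
    zero-sum⇒relCycle ne eq , λ S⊆C (S-ne , _ , s) → minimal S⊆C S-ne (span-none ∉⊥ s)

  relCircuit⇒circuit : ∀ {C} → RelCircuit ∅ C → Circuit C
  relCircuit⇒circuit ((ne , _ , s) , minimal) =
    ne , span-none ∉⊥ s , λ D⊆C D-ne eq → minimal D⊆C (zero-sum⇒relCycle D-ne eq)

  circuit-isCyclic : ∀ {C} → sumOver v C ≡ zeroVec → IsCyclic C
  circuit-isCyclic {C} eq {e} e∈C =
    subst (Span v _) (trans (sumOver-toggle v C e) (trans (cong (v e ⊕_) eq) (⊕-identityʳ _))) (sum∈span′ sub)
    where
    sub : ∀ {x} → x ∈ ⁅ e ⁆ ⊕ C → x ∈ C × x ≢ e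
    sub x∈ with ∈⊕⁻ x∈
    ... | inj₁ (p , x∉C) = contradiction (subst (_∈ C) (sym (x∈⁅y⁆⇒x≡y e p)) e∈C) x∉C
    ... | inj₂ (x∉e , x∈C) = x∈C , λ { refl → x∉e (x∈⁅x⁆ e) }

  ∅∪⊆ : ∀ {X : Subset n} {x} → x ∈ ∅ ∪ X → x ∈ X
  ∅∪⊆ {X} x∈ = [ (λ p → contradiction p ∉⊥) , id ]′ (x∈p∪q⁻ ∅ X x∈)

  -- A cycle inside the closure of `C` that did not span `C` would give a forbidden chain, the
  -- closure of `C` being proper because of `h`. So `parallel-mod` applies over the empty flat: an
  -- element spanned by `C` outside it would be parallel to an element of `C`.
  circuit-isFlat : ∀ {C h} → Circuit C → ¬ Span v (_∈ C) (v h) → IsFlat C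
  circuit-isFlat {C} {h} circ@(ne , eq , _) ¬h {g} s = decidable-stable (g ∈? C) λ g∉C →
    let t , t∈C , p = parallel-mod ∅-isFlat (circuit⇒relCircuit circ) spans (span-map (q⊆p∪q ∅ C) s) ∉⊥ g∉C
    in g∉C (subst (_∈ C) (sym (no-parallel (⊕≡0⇒≡ (span-none ∉⊥ p)))) t∈C)
    where
    spans : ∀ {S} → RelCycle ∅ S → (∀ {x} → x ∈ S → Span v (_∈ ∅ ∪ C) (v x)) →
            ∀ {t} → t ∈ C → Span v (_∈ ∅ ∪ S) (v t)
    spans {S} c@((y , y∈S) , _) S-spanned {t} t∈C = decidable-stable (span? v (∅ ∪ S) (v t)) λ ¬s →
      no-chain {cl (∅ ∪ S)} {cl (∅ ∪ C)} {h}
        (cl-isFlat _) (cl-isCyclic ∅-isCyclic c)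
        (cl-isFlat _) (cl-isCyclic ∅-isCyclic (zero-sum⇒relCycle ne eq))
        (y , cl-extensive (q⊆p∪q ∅ S y∈S))
        ((λ x∈ → ∈cl⁺ (span-bind (S-spanned ∘ ∅∪⊆) (∈cl⁻ x∈))) , t , cl-extensive (q⊆p∪q ∅ C t∈C) , ¬s ∘ ∈cl⁻)
        (λ h∈ → ¬h (span-map ∅∪⊆ (∈cl⁻ h∈)))

  module CircuitFlat {Z : Subset n} (circ : Circuit Z) (flat : IsFlat Z) where
    private
      ne      = proj₁ circ
      sum≡0   = proj₁ (proj₂ circ)
      minimal = λ {D} → proj₂ (proj₂ circ) {D}

    -- `Z` itself is the lower member of the chain and the closure of `Z ∪ T` the upper one, which
    -- therefore cannot be proper.
    coatom : ∀ {T} → RelCycle Z T → ∀ g → Span v (_∈ Z ∪ T) (v g)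
    coatom {T} c@((t , t∈T) , disj , _) g = decidable-stable (span? v (Z ∪ T) (v g)) λ ¬s →
      no-chain {Z} {cl (Z ∪ T)} {g} flat (circuit-isCyclic sum≡0)
        (cl-isFlat _) (cl-isCyclic (circuit-isCyclic sum≡0) c) ne
        ((λ x∈ → cl-extensive (p⊆p∪q T x∈)) , t , cl-extensive (q⊆p∪q Z T t∈T) , disj t t∈T)
        (¬s ∘ ∈cl⁻)

    -- This is where η(E) ≠ 2 enters: if `Z` and `T` covered everything, removing one element `s` of
    -- `Z` and one element `t` of `T` would leave a basis.
    not-all : ∀ {T} → RelCircuit Z T → ¬ (∀ g → g ∈ Z ⊎ g ∈ T)
    not-all {T} (((t , t∈T) , disj , sT) , T-minimal) all = nullity≢2 s≢t span-s span-t ind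
      where
      s = proj₁ ne
      s≢t : s ≢ t
      s≢t eq = disj t t∈T (subst (_∈ Z) eq (proj₂ ne))
      ≢t : ∀ {x} → x ∈ Z → x ≢ t
      ≢t x∈Z refl = disj t t∈T x∈Z
      span-s : Span v (λ x → x ≢ s × x ≢ t) (v s)
      span-s = span-map (λ (x∈Z , x≢s) → x≢s , ≢t x∈Z) (circuit-isCyclic sum≡0 (proj₂ ne))
      from-Z : ∀ {x} → x ∈ Z → Span v (λ x → x ≢ s × x ≢ t) (v x)
      from-Z {x} x∈Z with x Fin.≟ s
      ... | yes refl = span-s
      ... | no x≢s   = span-gen (x≢s , ≢t x∈Z)
      others : ∀ {x} → x ∈ ⁅ t ⁆ ⊕ T → x ≢ s × x ≢ t
      others x∈ with ∈⊕⁻ x∈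
      ... | inj₁ (p , x∉T) = contradiction (subst (_∈ T) (sym (x∈⁅y⁆⇒x≡y t p)) t∈T) x∉T
      ... | inj₂ (x∉t , x∈T) = (λ { refl → disj s x∈T (proj₂ ne) }) , λ { refl → x∉t (x∈⁅x⁆ t) }
      span-t : Span v (λ x → x ≢ s × x ≢ t) (v t)
      span-t = span-cancelʳ (span-bind from-Z sT) (subst (Span v _) (sumOver-toggle v T t) (sum∈span′ others))
      ind : Independent v ((⊤ - s) - t)
      -- A zero sum that meets `T` meets it in a cycle of the contraction, hence contains `t`; one
      -- that misses `T` lies in `Z`, hence contains `s`.
      ind Q Q⊆ Q-ne Q≡0 with nonempty? (Q ∩ T)
      ... | yes QT-ne = t∉Q (p∩q⊆p Q T (T-minimal (p∩q⊆q Q T) QT-cycle t∈T))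
        where
        t∉Q : t ∉ Q
        t∉Q t∈Q = proj₂ (x∈p-y⁻ (Q⊆ t∈Q)) refl
        in-Z : ∀ {x} → x ∈ Q ─ T → x ∈ Z
        in-Z {x} x∈ = [ id , (λ x∈T → contradiction x∈T (x∈p─q⇒x∉q x∈)) ]′ (all x)
        sums : sumOver v (Q ─ T) ≡ sumOver v (Q ∩ T)
        sums = sym (⊕≡0⇒≡ (trans (sym (sumOver-⊕ v (Q ∩ T) (Q ─ T)))
          (trans (cong (sumOver v) (sym (partition Q T))) Q≡0)))
        QT-cycle : RelCycle Z (Q ∩ T)
        QT-cycle = QT-ne , (λ x x∈ → disj x (p∩q⊆q Q T x∈)) , subst (Span v _) sums (sum∈span′ in-Z)
      ... | no QT-empty = proj₂ (x∈p-y⁻ (proj₁ (x∈p-y⁻ (Q⊆ (minimal Q⊆Z Q-ne Q≡0 (proj₂ ne)))))) refl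
        where
        Q⊆Z : Q ⊆ Z
        Q⊆Z {x} x∈Q = [ id , (λ x∈T → contradiction (x , x∈p∩q⁺ (x∈Q , x∈T)) QT-empty) ]′ (all x)

    record Outside : Set where
      field
        {e f g}   : Fin n
        e∉Z       : e ∉ Z
        f∉Z       : f ∉ Z
        g∉Z       : g ∉ Z
        e≢f       : e ≢ f
        e≢g       : e ≢ g
        f≢g       : f ≢ g
        congruent : ∀ {x y} → x ∉ Z → y ∉ Z → Span v (_∈ Z) (v x ⊕ v y)

    private
      h-split : ∀ {h x} → x ≢ h → x ∈ Z ⊎ (x ∉ Z × x ≢ h)
      h-split {x = x} x≢h with x ∈? Z
      ... | yes p = inj₁ p
      ... | no p  = inj₂ (p , x≢h)

    -- As `h` is no isthmus, it lies on a cycle of the contraction, which contains a circuit `T`. By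
    -- `not-all` some `e` lies outside `Z` and `T`, and it is parallel modulo `Z` to some `f` in
    -- `T`. A second element `g` of `T` exists, since `T = ⁅ f ⁆` would put `f` in the flat `Z`.
    outside-structure : ∀ {h} → h ∉ Z → Outside
    outside-structure {h} h∉Z
      with A , A-out , sA ← span-split h-split (no-isthmus h)
      with T , _ , T-circ@(((_ , disj , sT)) , _) ←
             relCircuit-below (relCycle-insert (proj₁ ∘ A-out) h∉Z (λ h∈A → proj₂ (A-out h∈A) refl) sA)
      with Fin.any? (λ e → ¬? (e ∈? Z) ×-dec ¬? (e ∈? T))
    ... | no none = ⊥-elim (not-all T-circ λ g → in-one g)
      where
      in-one : ∀ g → g ∈ Z ⊎ g ∈ T
      in-one g with g ∈? Z | g ∈? T
      ... | yes p | _     = inj₁ p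
      ... | no p  | yes q = inj₂ q
      ... | no p  | no q  = contradiction (g , p , q) none
    ... | yes (e , e∉Z , e∉T)
      with f , f∈T , ef ← parallel-mod flat T-circ (λ c _ {t} _ → coatom c t) (coatom (proj₁ T-circ) e) e∉Z e∉T
      with Fin.any? (λ g → g ∈? T ×-dec ¬? (g Fin.≟ f))
    ...   | no none = contradiction
        (flat (subst (Span v (_∈ Z)) (trans (cong (sumOver v) T≡f) (sumOver-⁅⁆ v f)) sT)) (disj f f∈T)
      where
      T≡f : T ≡ ⁅ f ⁆
      T≡f = ⊆-antisym
        (λ {x} x∈T → subst (_∈ ⁅ f ⁆) (sym (decidable-stable (x Fin.≟ f) (λ x≢f → none (x , x∈T , x≢f)))) (x∈⁅x⁆ f))
        (λ x∈f → subst (_∈ T) (sym (x∈⁅y⁆⇒x≡y f x∈f)) f∈T)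
    ...   | yes (g , g∈T , g≢f) = record
      { e∉Z = e∉Z ; f∉Z = disj f f∈T ; g∉Z = disj g g∈T
      ; e≢f = λ { refl → e∉T f∈T } ; e≢g = λ { refl → e∉T g∈T } ; f≢g = g≢f ∘ sym
      ; congruent = λ {x} {y} x∉Z y∉Z →
          subst (Span v _) (telescope (v e) (v x) (v y)) (span-⊕ (to-e x∉Z) (to-e y∉Z)) }
      where
      telescope : (a b c : Vec Bool r) → (a ⊕ b) ⊕ (a ⊕ c) ≡ b ⊕ c
      telescope a b c = trans (⊕-interchange a b a c) (trans (cong (_⊕ _) (⊕-self a)) (⊕-identityˡ _))
      e≢f : e ≢ f
      e≢f refl = e∉T f∈T
      -- The pair is itself a cycle of the contraction, so it spans everything together with `Z`; as
      -- `f` is congruent to `e`, so do `Z` and `e` alone.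
      fe-cycle : RelCycle Z (⁅ e ⁆ ⊕ ⁅ f ⁆)
      fe-cycle = relCycle-insert (λ x∈f → subst (_∉ Z) (sym (x∈⁅y⁆⇒x≡y f x∈f)) (disj f f∈T)) e∉Z
        (x≢y⇒x∉⁅y⁆ e≢f) (subst (Span v _) (trans (⊕-comm (v e) (v f)) (cong (_⊕ v e) (sym (sumOver-⁅⁆ v f)))) ef)
      generated : ∀ {x} → x ∈ Z ∪ (⁅ e ⁆ ⊕ ⁅ f ⁆) → Span v (λ y → y ∈ Z ⊎ y ≡ e) (v x)
      generated x∈ with x∈p∪q⁻ Z _ x∈
      ... | inj₁ p = span-gen (inj₁ p)
      ... | inj₂ p with ∈⊕⇒⊎ p
      ...   | inj₁ q rewrite x∈⁅y⁆⇒x≡y e q = span-gen (inj₂ refl)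
      ...   | inj₂ q rewrite x∈⁅y⁆⇒x≡y f q = span-cancel (span-gen (inj₂ refl)) (span-map inj₁ ef)
      to-e : ∀ {x} → x ∉ Z → Span v (_∈ Z) (v e ⊕ v x)
      to-e {x} x∉Z with span-insert (span-bind generated (coatom fe-cycle x))
      ... | inj₁ s = contradiction (flat s) x∉Z
      ... | inj₂ s = s

  circuit-congruent : ∀ {C x y} → Circuit C → x ∉ C → y ∉ C → Span v (_∈ C) (v x ⊕ v y)
  circuit-congruent {C} {x} {y} circ x∉C y∉C with span? v C (v x) | span? v C (v y)
  ... | yes sx | yes sy = span-⊕ sx sy
  ... | no ¬s  | _      = CircuitFlat.Outside.congruent
    (CircuitFlat.outside-structure circ (circuit-isFlat circ ¬s) (¬s ∘ span-gen)) x∉C y∉C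
  ... | _      | no ¬s  = CircuitFlat.Outside.congruent
    (CircuitFlat.outside-structure circ (circuit-isFlat circ ¬s) (¬s ∘ span-gen)) x∉C y∉C

  -- If v e + v f is the sum of S ⊂ Z, then D = {e, f} ∪ S is a circuit too, so two elements of
  -- Z ∖ S are congruent modulo D, hence modulo S, and minimality of Z leaves no room for a third.
  no-three-outside : ∀ {Z S e f a b c} → Circuit Z → IsFlat Z → e ∉ Z → f ∉ Z → e ≢ f →
    S ⊆ Z → v e ⊕ v f ≡ sumOver v S → a ∈ Z ─ S → b ∈ Z ─ S → c ∈ Z ─ S → a ≢ b → a ≢ c → b ≢ c → ⊥
  no-three-outside {Z} {S} {e} {f} {a} {b} {c} (_ , _ , minimal) flat e∉Z f∉Z e≢f S⊆Z ef≡S a∈ b∈ c∈ a≢b a≢c b≢c =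
    conclude (span⇒sum ab-mod-S)
    where
    in-Z : ∀ {x} → x ∈ Z ─ S → x ∈ Z
    in-Z = p─q⊆p Z S
    ∉S : ∀ {x} → x ∈ Z ─ S → x ∉ S
    ∉S = x∈p─q⇒x∉q
    D : Subset n
    D = ⁅ e ⁆ ⊕ (⁅ f ⁆ ⊕ S)
    e∉fS : e ∉ ⁅ f ⁆ ⊕ S
    e∉fS p = [ e≢f ∘ x∈⁅y⁆⇒x≡y f , e∉Z ∘ S⊆Z ]′ (∈⊕⇒⊎ p)
    e∈D : e ∈ D
    e∈D = ∈⊕ˡ (x∈⁅x⁆ e) e∉fS
    D-cases : ∀ {x} → x ∈ D → (x ∈ S ⊎ x ≡ f) ⊎ x ≡ e
    D-cases p with ∈⊕⇒⊎ p
    ... | inj₁ q = inj₂ (x∈⁅y⁆⇒x≡y e q)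
    ... | inj₂ q with ∈⊕⇒⊎ q
    ...   | inj₁ q′ = inj₁ (inj₂ (x∈⁅y⁆⇒x≡y f q′))
    ...   | inj₂ q′ = inj₁ (inj₁ q′)
    ∉D : ∀ {x} → x ∈ Z ─ S → x ∉ D
    ∉D p q with D-cases q
    ... | inj₁ (inj₁ r)    = ∉S p r
    ... | inj₁ (inj₂ refl) = f∉Z (in-Z p)
    ... | inj₂ refl        = e∉Z (in-Z p)
    D≡0 : sumOver v D ≡ zeroVec
    D≡0 = trans (sumOver-toggle v _ e) (trans (cong (v e ⊕_) (sumOver-toggle v S f))
      (trans (sym (⊕-assoc (v e) (v f) _)) (≡⇒⊕≡0 ef≡S)))
    -- `S` is a proper part of the circuit `Z`, because `a` is missing.
    in-S : ∀ {Q} → Q ⊆ S → sumOver v Q ≡ zeroVec → Empty Q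
    in-S Q⊆S Q≡0 ne = ∉S a∈ (Q⊆S (minimal (λ p → S⊆Z (Q⊆S p)) ne Q≡0 (in-Z a∈)))
    D-circuit : Circuit D
    D-circuit = (e , e∈D) , D≡0 , D-minimal
      where
      -- If `Q` contains both `e` and `f`, its complement in `D` is a zero sum inside `S`; if
      -- neither, `Q` itself is one. If it contains just one of them, that element is spanned by
      -- `Z`, which is a flat.
      D-minimal : ∀ {Q} → Q ⊆ D → Nonempty Q → sumOver v Q ≡ zeroVec → D ⊆ Q
      D-minimal {Q} Q⊆D ne Q≡0 {x} x∈D with e ∈? Q | f ∈? Q
      ... | yes e∈Q | yes f∈Q = decidable-stable (x ∈? Q) λ x∉Q →
          in-S rest⊆S (trans (sumOver-⊕ v D Q) (trans (cong₂ _⊕_ D≡0 Q≡0) (⊕-self _))) (x , ∈⊕ˡ x∈D x∉Q)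
        where
        rest⊆S : D ⊕ Q ⊆ S
        rest⊆S p with ∈⊕⁻ p
        ... | inj₂ (x∉D , x∈Q) = contradiction (Q⊆D x∈Q) x∉D
        ... | inj₁ (x∈D , x∉Q) with D-cases x∈D
        ...   | inj₁ (inj₁ q)    = q
        ...   | inj₁ (inj₂ refl) = contradiction f∈Q x∉Q
        ...   | inj₂ refl        = contradiction e∈Q x∉Q
      ... | no e∉Q | no f∉Q = contradiction ne (in-S Q⊆S Q≡0)
        where
        Q⊆S : Q ⊆ S
        Q⊆S p with D-cases (Q⊆D p)
        ... | inj₁ (inj₁ q)    = q
        ... | inj₁ (inj₂ refl) = contradiction p f∉Q
        ... | inj₂ refl        = contradiction p e∉Q
      ... | yes e∈Q | no f∉Q = contradiction (flat (span-map sub (circuit-isCyclic Q≡0 e∈Q))) e∉Z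
        where
        sub : ∀ {x} → x ∈ Q × x ≢ e → x ∈ Z
        sub (p , x≢e) with D-cases (Q⊆D p)
        ... | inj₁ (inj₁ q)    = S⊆Z q
        ... | inj₁ (inj₂ refl) = contradiction p f∉Q
        ... | inj₂ x≡e         = contradiction x≡e x≢e
      ... | no e∉Q | yes f∈Q = contradiction (flat (span-map sub (circuit-isCyclic Q≡0 f∈Q))) f∉Z
        where
        sub : ∀ {x} → x ∈ Q × x ≢ f → x ∈ Z
        sub (p , x≢f) with D-cases (Q⊆D p)
        ... | inj₁ (inj₁ q)   = S⊆Z q
        ... | inj₁ (inj₂ x≡f) = contradiction x≡f x≢f
        ... | inj₂ refl       = contradiction p e∉Q
    ab-in-Z : Span v (_∈ Z) (v a ⊕ v b)
    ab-in-Z = span-⊕ (span-gen (in-Z a∈)) (span-gen (in-Z b∈))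
    not-in-span : ∀ {x} → x ∉ Z → ¬ Span v (_∈ S) (v x ⊕ (v a ⊕ v b))
    not-in-span x∉Z s = x∉Z (flat (span-cancelʳ ab-in-Z (span-map S⊆Z s)))
    -- Using only one of `e` and `f` would put it in the span of `Z`; using both adds the sum of
    -- `S`, which is absorbed.
    ab-mod-S : Span v (_∈ S) (v a ⊕ v b)
    ab-mod-S with span-insert (span-map D-cases (circuit-congruent D-circuit (∉D a∈) (∉D b∈)))
    ab-mod-S | inj₁ s with span-insert s
    ... | inj₁ t = t
    ... | inj₂ t = contradiction t (not-in-span f∉Z)
    ab-mod-S | inj₂ s with span-insert s
    ... | inj₁ t = contradiction t (not-in-span e∉Z)
    ... | inj₂ t = span-cancel (sum∈span v S) (subst (Span v _) (begin
        v f ⊕ (v e ⊕ (v a ⊕ v b))  ≡⟨ ⊕-leftComm (v f) (v e) _ ⟩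
        v e ⊕ (v f ⊕ (v a ⊕ v b))  ≡⟨ ⊕-assoc (v e) (v f) _ ⟨
        (v e ⊕ v f) ⊕ (v a ⊕ v b)  ≡⟨ cong (_⊕ _) ef≡S ⟩
        sumOver v S ⊕ (v a ⊕ v b)  ∎) t)
      where open ≡-Reasoning
    abB : Subset n → Subset n
    abB B = (⁅ a ⁆ ⊕ ⁅ b ⁆) ⊕ B
    abB⊆Z : ∀ B → (∀ {x} → x ∈ B → x ∈ S) → abB B ⊆ Z
    abB⊆Z B B⊆S p with ∈⊕⇒⊎ p
    ... | inj₂ q = S⊆Z (B⊆S q)
    ... | inj₁ q with ∈⊕⇒⊎ q
    ...   | inj₁ q′ = subst (_∈ Z) (sym (x∈⁅y⁆⇒x≡y a q′)) (in-Z a∈)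
    ...   | inj₂ q′ = subst (_∈ Z) (sym (x∈⁅y⁆⇒x≡y b q′)) (in-Z b∈)
    a∈abB : ∀ B → (∀ {x} → x ∈ B → x ∈ S) → a ∈ abB B
    a∈abB B B⊆S = ∈⊕ˡ (∈⊕ˡ (x∈⁅x⁆ a) (x≢y⇒x∉⁅y⁆ a≢b)) (∉S a∈ ∘ B⊆S)
    abB≡0 : ∀ B → sumOver v B ≡ v a ⊕ v b → sumOver v (abB B) ≡ zeroVec
    abB≡0 B eq = trans (sumOver-⊕ v (⁅ a ⁆ ⊕ ⁅ b ⁆) B) (≡⇒⊕≡0 (trans (sumOver-toggle v ⁅ b ⁆ a)
      (trans (cong (v a ⊕_) (sumOver-⁅⁆ v b)) (sym eq))))
    -- Now `a`, `b` and `B` form a zero sum inside `Z`, hence all of `Z`, but `c` is not among them.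
    conclude : ∃[ B ] (∀ {x} → x ∈ B → x ∈ S) × sumOver v B ≡ v a ⊕ v b → ⊥
    conclude (B , B⊆S , B≡ab) with ∈⊕⇒⊎ (minimal {abB B} (abB⊆Z B B⊆S) (a , a∈abB B B⊆S) (abB≡0 B B≡ab) (in-Z c∈))
    ... | inj₂ p = ∉S c∈ (B⊆S p)
    ... | inj₁ p = [ a≢c ∘ sym ∘ x∈⁅y⁆⇒x≡y a , b≢c ∘ sym ∘ x∈⁅y⁆⇒x≡y b ]′ (∈⊕⇒⊎ p)

  Enumeration : ℕ → Subset n → Set
  Enumeration k Z = ∃[ xs ] Unique {n = k} xs × All (_∈ Z) xs × (∀ {x} → x ∈ Z → x ∈ᵛ xs)

  module _ {Z : Subset n} (circ : Circuit Z) (flat : IsFlat Z) where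

    -- The complement of `S` in `Z` has the same sum as `S`, since `Z` sums to zero.
    no-three-inside : ∀ {S e f a b c} → e ∉ Z → f ∉ Z → e ≢ f → S ⊆ Z → v e ⊕ v f ≡ sumOver v S →
                      a ∈ S → b ∈ S → c ∈ S → a ≢ b → a ≢ c → b ≢ c → ⊥
    no-three-inside {S} {e} {f} e∉Z f∉Z e≢f S⊆Z ef≡S a∈ b∈ c∈ =
      no-three-outside {S = Z ⊕ S} circ flat e∉Z f∉Z e≢f sub
        (trans ef≡S (sym (trans (sumOver-⊕ v Z S) (trans (cong (_⊕ _) (proj₁ (proj₂ circ))) (⊕-identityˡ _)))))
        (out a∈) (out b∈) (out c∈)
      where
      sub : Z ⊕ S ⊆ Z
      sub p = [ id , (λ q → S⊆Z q) ]′ (∈⊕⇒⊎ p)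
      out : ∀ {x} → x ∈ S → x ∈ Z ─ (Z ⊕ S)
      out p = x∈p∧x∉q⇒x∈p─q (S⊆Z p) λ q → [ (λ r → proj₂ r p) , (λ r → proj₁ r (S⊆Z p)) ]′ (∈⊕⁻ q)

    -- Both `S` and `Z ─ S` are nonempty, as otherwise `v e ≡ v f`. They have at most two elements
    -- each, and not one each, since then the two elements of `Z` would be parallel.
    circuit-enumeration : ∀ {e f} → e ∉ Z → f ∉ Z → e ≢ f → Enumeration 3 Z ⊎ Enumeration 4 Z
    circuit-enumeration {e} {f} e∉Z f∉Z e≢f
      with S , S⊆Z , S≡ef ← span⇒sum (circuit-congruent circ e∉Z f∉Z)
      with nonempty? S | nonempty? (Z ─ S)
    ... | no S-empty | _ = contradiction (no-parallel (⊕≡0⇒≡ (trans (sym S≡ef) (sumOver-empty v S-empty)))) e≢f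
    ... | _ | no Z─S-empty = contradiction
        (no-parallel (⊕≡0⇒≡ (trans (sym S≡ef) (trans (cong (sumOver v) S≡Z) (proj₁ (proj₂ circ)))))) e≢f
      where
      S≡Z : S ≡ Z
      S≡Z = ⊆-antisym S⊆Z λ {x} x∈Z → decidable-stable (x ∈? S) λ x∉S → Z─S-empty (x , x∈p∧x∉q⇒x∈p─q x∈Z x∉S)
    ... | yes (a , a∈S) | yes (c , c∈)
      with Fin.any? (λ b → b ∈? S ×-dec ¬? (b Fin.≟ a)) | Fin.any? (λ d → d ∈? Z ─ S ×-dec ¬? (d Fin.≟ c))
    ...   | b? | d? = cases b? d?
      where
      c∈Z : c ∈ Z
      c∈Z = p─q⊆p Z S c∈
      across : ∀ {x y} → x ∈ S → y ∈ Z ─ S → x ≢ y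
      across x∈ y∈ refl = x∈p─q⇒x∉q y∈ x∈
      only : ∀ {W y} → ¬ (∃[ x ] x ∈ W × x ≢ y) → ∀ {x} → x ∈ W → x ≡ y
      only {y = y} none {x} x∈ = decidable-stable (x Fin.≟ y) λ x≢y → none (x , x∈ , x≢y)
      pair-covers : ∀ {W} → (∀ {x y z} → x ∈ W → y ∈ W → z ∈ W → x ≢ y → x ≢ z → y ≢ z → ⊥) →
                    ∀ {x y} → x ∈ W → y ∈ W → x ≢ y → ∀ {z} → z ∈ W → z ≡ x ⊎ z ≡ y
      pair-covers no-three {x} {y} x∈ y∈ x≢y {z} z∈ with z Fin.≟ x | z Fin.≟ y
      ... | yes p | _     = inj₁ p
      ... | _     | yes q = inj₂ q
      ... | no p  | no q  = ⊥-elim (no-three x∈ y∈ z∈ x≢y (p ∘ sym) (q ∘ sym))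
      S-two = pair-covers (no-three-inside e∉Z f∉Z e≢f S⊆Z (sym S≡ef))
      Z─S-two = pair-covers (no-three-outside circ flat e∉Z f∉Z e≢f S⊆Z (sym S≡ef))
      split : ∀ {x} → x ∈ Z → x ∈ S ⊎ x ∈ Z ─ S
      split {x} x∈Z with x ∈? S
      ... | yes p = inj₁ p
      ... | no p  = inj₂ (x∈p∧x∉q⇒x∈p─q x∈Z p)
      either : ∀ {x y z} {xs : Vec (Fin n) k} → z ≡ x ⊎ z ≡ y → z ∈ᵛ x ∷ y ∷ xs
      either (inj₁ p) = here p
      either (inj₂ p) = there (here p)
      cases : Dec (∃[ b ] b ∈ S × b ≢ a) → Dec (∃[ d ] d ∈ Z ─ S × d ≢ c) → Enumeration 3 Z ⊎ Enumeration 4 Z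
      cases (no ¬b) (no ¬d) = contradiction (no-parallel (⊕≡0⇒≡ ac≡0)) (across a∈S c∈)
        where
        ac≡0 : v a ⊕ v c ≡ zeroVec
        ac≡0 = trans (cong (v a ⊕_) (sym (⊕-identityʳ (v c)))) (trans (sym (sumOver-enumerate-all v (a ∷ c ∷ [])
          ((across a∈S c∈ ∷ []) ∷ [] ∷ []) (S⊆Z a∈S ∷ c∈Z ∷ [])
          (λ x∈Z → [ here ∘ only ¬b , (λ q → there (here (only ¬d q))) ]′ (split x∈Z)))) (proj₁ (proj₂ circ)))
      cases (yes (b , b∈S , b≢a)) (no ¬d) = inj₁
        ( a ∷ b ∷ c ∷ []
        , ((b≢a ∘ sym) ∷ across a∈S c∈ ∷ []) ∷ (across b∈S c∈ ∷ []) ∷ [] ∷ []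
        , S⊆Z a∈S ∷ S⊆Z b∈S ∷ c∈Z ∷ []
        , λ x∈Z → [ (λ p → either (S-two a∈S b∈S (b≢a ∘ sym) p))
                  , (λ p → there (there (here (only ¬d p)))) ]′ (split x∈Z) )
      cases (no ¬b) (yes (d , d∈ , d≢c)) = inj₁
        ( a ∷ c ∷ d ∷ []
        , (across a∈S c∈ ∷ across a∈S d∈ ∷ []) ∷ ((d≢c ∘ sym) ∷ []) ∷ [] ∷ []
        , S⊆Z a∈S ∷ c∈Z ∷ p─q⊆p Z S d∈ ∷ []
        , λ x∈Z → [ (λ p → here (only ¬b p))
                  , (λ p → there (either (Z─S-two c∈ d∈ (d≢c ∘ sym) p))) ]′ (split x∈Z) )
      cases (yes (b , b∈S , b≢a)) (yes (d , d∈ , d≢c)) = inj₂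
        ( a ∷ b ∷ c ∷ d ∷ []
        , ((b≢a ∘ sym) ∷ across a∈S c∈ ∷ across a∈S d∈ ∷ []) ∷ (across b∈S c∈ ∷ across b∈S d∈ ∷ []) ∷
          ((d≢c ∘ sym) ∷ []) ∷ [] ∷ []
        , S⊆Z a∈S ∷ S⊆Z b∈S ∷ c∈Z ∷ p─q⊆p Z S d∈ ∷ []
        , λ x∈Z → [ (λ p → either (S-two a∈S b∈S (b≢a ∘ sym) p))
                  , (λ p → there (there (either (Z─S-two c∈ d∈ (d≢c ∘ sym) p)))) ]′ (split x∈Z) )

    outside≢ : ∀ {e} {xs : Vec (Fin n) k} → e ∉ Z → All (_∈ Z) xs → All (e ≢_) xs
    outside≢ e∉Z = All.map λ { x∈Z refl → e∉Z x∈Z }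

    -- For `k` equal to 3 or 4 this is one less than the number of columns of `F₇` or `A₈`, so at
    -- most one column is missed.
    size-bound : CircuitFlat.Outside circ flat → Enumeration k Z → 3 + k ≤ n
    size-bound o (xs , uniq , xs⊆Z , _) = Fin.injective⇒≤ λ {i} {j} → lookup-injective unique i j
      where
      open CircuitFlat.Outside o
      unique : Unique (e ∷ f ∷ g ∷ xs)
      unique = (e≢f ∷ e≢g ∷ outside≢ e∉Z xs⊆Z) ∷ (f≢g ∷ outside≢ f∉Z xs⊆Z) ∷ outside≢ g∉Z xs⊆Z ∷ uniq

    outside-independent : ∀ {e} {xs : Vec (Fin n) k} → e ∉ Z → All (_∈ Z) xs →
                          Independent (v ∘ lookup xs) ⊤ → Independent (v ∘ lookup (e ∷ xs)) ⊤
    outside-independent {e = e} {xs} e∉Z xs⊆Z = independent-∷ (v ∘ lookup (e ∷ xs)) λ u eq →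
      e∉Z (flat (subst (Span v (_∈ Z)) (sym eq) (span-∘ (λ {i} _ → lookup⁺ xs⊆Z i) (sum∈span (v ∘ lookup xs) u))))

    triangle-coordinates : ∀ {e} → e ∉ Z → (∀ {x y} → x ∉ Z → y ∉ Z → Span v (_∈ Z) (v x ⊕ v y)) → Enumeration 3 Z →
      ∃[ b ] Independent (v ∘ lookup {n = 3} b) ⊤ × (∀ g → ∃[ u ] v g ≡ sumOver (v ∘ lookup b) u)
    triangle-coordinates {e} e∉Z congruent
      (a ∷ b ∷ c ∷ [] , uniq@((a≢b ∷ a≢c ∷ []) ∷ (b≢c ∷ []) ∷ [] ∷ []) , Z∋@(a∈ ∷ b∈ ∷ c∈ ∷ []) , cover) =
      e ∷ a ∷ b ∷ [] , outside-independent e∉Z (a∈ ∷ b∈ ∷ []) ab-independent , coordinates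
      where
      w = v ∘ lookup (e ∷ a ∷ b ∷ [])
      ab-independent : Independent (v ∘ lookup (a ∷ b ∷ [])) ⊤
      ab-independent = independent-∷ _
        (λ { (true ∷ []) eq → a≢b (no-parallel (trans eq (⊕-identityʳ _))) ; (false ∷ []) eq → no-loop a eq })
        (independent-∷ _ (λ { [] eq → no-loop b eq }) λ { _ _ (() , _) })
      v-c : v c ≡ v a ⊕ (v b ⊕ zeroVec)
      v-c = sym (⊕≡0⇒≡ (begin
        (v a ⊕ (v b ⊕ zeroVec)) ⊕ v c  ≡⟨ cong (λ y → (v a ⊕ y) ⊕ v c) (⊕-identityʳ (v b)) ⟩
        (v a ⊕ v b) ⊕ v c              ≡⟨ ⊕-assoc (v a) (v b) (v c) ⟩
        v a ⊕ (v b ⊕ v c)              ≡⟨ cong (λ y → v a ⊕ (v b ⊕ y)) (⊕-identityʳ (v c)) ⟨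
        v a ⊕ (v b ⊕ (v c ⊕ zeroVec))  ≡⟨ sumOver-enumerate-all v (a ∷ b ∷ c ∷ []) uniq Z∋ cover ⟨
        sumOver v Z                    ≡⟨ proj₁ (proj₂ circ) ⟩
        zeroVec                        ∎))
        where open ≡-Reasoning
      on-basis : ∀ {x} → x ∈ Z ⊎ x ≡ e → ∃[ u ] v x ≡ sumOver w u
      on-basis (inj₂ refl) = ⁅ zero ⁆ , sym (sumOver-⁅⁆ w zero)
      on-basis (inj₁ x∈Z) with cover x∈Z
      ... | here refl                 = ⁅ suc zero ⁆ , sym (sumOver-⁅⁆ w (suc zero))
      ... | there (here refl)         = ⁅ suc (suc zero) ⁆ , sym (sumOver-⁅⁆ w (suc (suc zero)))
      ... | there (there (here refl)) = false ∷ true ∷ true ∷ [] , v-c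
      coordinates : ∀ g → ∃[ u ] v g ≡ sumOver w u
      coordinates g with g ∈? Z
      ... | yes g∈Z = on-basis (inj₁ g∈Z)
      ... | no g∉Z  = span⇒coordinates w on-basis
        (span-cancelʳ (span-gen (inj₂ refl)) (span-map inj₁ (congruent g∉Z e∉Z)))

    -- In the basis `e`, `a`, `b`, `c` the element `d` is the sum of `a`, `b`, `c`, and an element
    -- outside `Z` is `e` plus an even number of `a`, `b`, `c`; all these weights are odd.
    quadrangle-coordinates : ∀ {e} → e ∉ Z → (∀ {x y} → x ∉ Z → y ∉ Z → Span v (_∈ Z) (v x ⊕ v y)) → Enumeration 4 Z →
      ∃[ b ] Independent (v ∘ lookup {n = 4} b) ⊤ × (∀ g → ∃[ u ] v g ≡ sumOver (v ∘ lookup b) u × parity u ≡ true)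
    quadrangle-coordinates {e} e∉Z congruent
      (a ∷ b ∷ c ∷ d ∷ [] , uniq@((a≢b ∷ a≢c ∷ a≢d ∷ []) ∷ (b≢c ∷ b≢d ∷ []) ∷ (c≢d ∷ []) ∷ [] ∷ [])
        , Z∋@(a∈ ∷ b∈ ∷ c∈ ∷ d∈ ∷ []) , cover) =
      e ∷ a ∷ b ∷ c ∷ [] , outside-independent e∉Z (a∈ ∷ b∈ ∷ c∈ ∷ []) abc-independent , coordinates
      where
      w = v ∘ lookup (e ∷ a ∷ b ∷ c ∷ [])
      abc = a ∷ b ∷ c ∷ []
      v-d : v d ≡ v a ⊕ (v b ⊕ (v c ⊕ zeroVec))
      v-d = sym (⊕≡0⇒≡ (begin
        (v a ⊕ (v b ⊕ (v c ⊕ zeroVec))) ⊕ v d  ≡⟨ cong (λ y → (v a ⊕ (v b ⊕ y)) ⊕ v d) (⊕-identityʳ (v c)) ⟩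
        (v a ⊕ (v b ⊕ v c)) ⊕ v d              ≡⟨ ⊕-assoc (v a) _ (v d) ⟩
        v a ⊕ ((v b ⊕ v c) ⊕ v d)              ≡⟨ cong (v a ⊕_) (⊕-assoc (v b) (v c) (v d)) ⟩
        v a ⊕ (v b ⊕ (v c ⊕ v d))              ≡⟨ cong (λ y → v a ⊕ (v b ⊕ (v c ⊕ y))) (⊕-identityʳ (v d)) ⟨
        v a ⊕ (v b ⊕ (v c ⊕ (v d ⊕ zeroVec)))  ≡⟨ sumOver-enumerate-all v (a ∷ b ∷ c ∷ d ∷ []) uniq Z∋ cover ⟨
        sumOver v Z                            ≡⟨ proj₁ (proj₂ circ) ⟩
        zeroVec                                ∎))
        where open ≡-Reasoning
      abc-independent : Independent (v ∘ lookup abc) ⊤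
      abc-independent = independent-∷ _
        (λ { (true ∷ true ∷ []) eq → no-loop d (trans v-d (≡⇒⊕≡0 eq))
           ; (true ∷ false ∷ []) eq → a≢b (no-parallel (trans eq (⊕-identityʳ _)))
           ; (false ∷ true ∷ []) eq → a≢c (no-parallel (trans eq (⊕-identityʳ _)))
           ; (false ∷ false ∷ []) eq → no-loop a eq })
        (independent-∷ _
          (λ { (true ∷ []) eq → b≢c (no-parallel (trans eq (⊕-identityʳ _))) ; (false ∷ []) eq → no-loop b eq })
          (independent-∷ _ (λ { [] eq → no-loop c eq }) λ { _ _ (() , _) }))

      -- The basis omits `d`; a set containing it is replaced by its complement in `Z`, which has
      -- the same sum.
      avoiding-d : ∀ {y} → Span v (_∈ Z) y → ∃[ S ] S ⊆ Z × d ∉ S × y ≡ sumOver v S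
      avoiding-d s with S , S⊆Z , eq ← span⇒sum s with d ∈? S
      ... | no d∉S  = S , S⊆Z , d∉S , sym eq
      ... | yes d∈S = Z ⊕ S , (λ p → [ id , (λ q → S⊆Z q) ]′ (∈⊕⇒⊎ p))
        , (λ p → [ (λ q → proj₂ q d∈S) , (λ q → proj₁ q d∈) ]′ (∈⊕⁻ p))
        , trans (sym eq) (sym (trans (sumOver-⊕ v Z S) (trans (cong (_⊕ _) (proj₁ (proj₂ circ))) (⊕-identityˡ _))))

      even : ∀ {g S} → g ∉ Z → g ≢ e → S ⊆ Z → d ∉ S → v g ⊕ v e ≡ sumOver v S →
             parity (Vector.map (lookup S) abc) ≡ false
      even {g} {S} g∉Z g≢e S⊆Z d∉S eq = bits (lookup S a) (lookup S b) (lookup S c) refl refl refl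
        where
        inS : ∀ {x} → lookup S x ≡ true → x ∈ S
        inS {x} = Vec.lookup⇒[]= x S
        out : ∀ {x} → x ∈ Z → lookup S x ≡ false → x ∈ Z ─ S
        out x∈Z p = x∈p∧x∉q⇒x∈p─q x∈Z λ x∈S → contradiction (trans (sym p) (Vec.[]=⇒lookup x∈S)) λ ()
        d-out : d ∈ Z ─ S
        d-out = x∈p∧x∉q⇒x∈p─q d∈ d∉S
        three : ∀ {x y z} → x ∈ Z ─ S → y ∈ Z ─ S → z ∈ Z ─ S → x ≢ y → x ≢ z → y ≢ z → ⊥
        three = no-three-outside circ flat g∉Z e∉Z g≢e S⊆Z eq
        -- Three bits give three elements of `S`; a single bit leaves the other two and `d` as three
        -- elements of `Z ─ S`.
        bits : ∀ x y z → lookup S a ≡ x → lookup S b ≡ y → lookup S c ≡ z → x xor (y xor (z xor false)) ≡ false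
        bits true true true p q r = ⊥-elim (no-three-inside g∉Z e∉Z g≢e S⊆Z eq (inS p) (inS q) (inS r) a≢b a≢c b≢c)
        bits true true false p q r = refl
        bits true false true p q r = refl
        bits true false false p q r = ⊥-elim (three (out b∈ q) (out c∈ r) d-out b≢c b≢d c≢d)
        bits false true true p q r = refl
        bits false true false p q r = ⊥-elim (three (out a∈ p) (out c∈ r) d-out a≢c a≢d c≢d)
        bits false false true p q r = ⊥-elim (three (out a∈ p) (out b∈ q) d-out a≢b a≢d b≢d)
        bits false false false p q r = refl

      coordinates : ∀ g → ∃[ u ] v g ≡ sumOver w u × parity u ≡ true
      coordinates g with g ∈? Z | g Fin.≟ e
      ... | _ | yes refl = ⁅ zero ⁆ , sym (sumOver-⁅⁆ w zero) , refl
      ... | yes g∈Z | _ with cover g∈Z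
      ...   | here refl = ⁅ suc zero ⁆ , sym (sumOver-⁅⁆ w (suc zero)) , refl
      ...   | there (here refl) = ⁅ suc (suc zero) ⁆ , sym (sumOver-⁅⁆ w (suc (suc zero))) , refl
      ...   | there (there (here refl)) = ⁅ suc (suc (suc zero)) ⁆ , sym (sumOver-⁅⁆ w (suc (suc (suc zero)))) , refl
      ...   | there (there (there (here refl))) = false ∷ true ∷ true ∷ true ∷ [] , v-d , refl
      coordinates g | no g∉Z | no g≢e with S , S⊆Z , d∉S , eq ← avoiding-d (congruent g∉Z e∉Z) =
        true ∷ Vector.map (lookup S) abc , v-g , cong not (even g∉Z g≢e S⊆Z d∉S eq)
        where
        in-abc : ∀ {x} → x ∈ S → x ∈ᵛ abc
        in-abc x∈S with cover (S⊆Z x∈S)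
        ... | here p                         = here p
        ... | there (here p)                 = there (here p)
        ... | there (there (here p))         = there (there (here p))
        ... | there (there (there (here refl))) = contradiction x∈S d∉S
        v-g : v g ≡ v e ⊕ sumOver (v ∘ lookup abc) (Vector.map (lookup S) abc)
        v-g = begin
          v g                  ≡⟨ ⊕-cancel (v e) (v g) ⟨
          v e ⊕ (v e ⊕ v g)    ≡⟨ cong (v e ⊕_) (⊕-comm (v e) (v g)) ⟩
          v e ⊕ (v g ⊕ v e)    ≡⟨ cong (v e ⊕_) eq ⟩
          v e ⊕ sumOver v S
            ≡⟨ cong (v e ⊕_) (sumOver-enumerate v abc ((a≢b ∷ a≢c ∷ []) ∷ (b≢c ∷ []) ∷ [] ∷ []) in-abc) ⟩
          v e ⊕ sumOver (v ∘ lookup abc) (Vector.map (lookup S) abc) ∎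
          where open ≡-Reasoning

  -- The odd vectors of F₂⁴ form an affine hyperplane with eight points, the affine space AG(3,2);
  -- they are the columns of `A₈`.
  Fano-like Affine-like : Set
  Fano-like   = 6 ≤ n × ∃[ b ] Independent (v ∘ lookup {n = 3} b) ⊤ ×
                (∀ g → ∃[ u ] v g ≡ sumOver (v ∘ lookup b) u)
  Affine-like = 7 ≤ n × ∃[ b ] Independent (v ∘ lookup {n = 4} b) ⊤ ×
                (∀ g → ∃[ u ] v g ≡ sumOver (v ∘ lookup b) u × parity u ≡ true)

  -- Cyclicity at `y` yields a circuit inside `Y`. It does not span `h`, hence is a flat.
  classification : ∀ {Y y h} → IsFlat Y → IsCyclic Y → y ∈ Y → h ∉ Y → Fano-like ⊎ Affine-like
  classification {Y} {y} {h} Y-flat Y-cyclic y∈Y h∉Y with A , A⊆ , eq ← span⇒sum (Y-cyclic y∈Y)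
    with Z , Z⊆ , Z-rel ← relCircuit-below (zero-sum⇒relCycle {⁅ y ⁆ ⊕ A}
      (y , ∈⊕ˡ (x∈⁅x⁆ y) (λ y∈A → proj₂ (A⊆ y∈A) refl)) (trans (sumOver-toggle v A y) (≡⇒⊕≡0 (sym eq))))
    = conclude (relCircuit⇒circuit Z-rel) Z⊆Y
    where
    Z⊆Y : ∀ {x} → x ∈ Z → x ∈ Y
    Z⊆Y x∈Z = [ (λ p → subst (_∈ Y) (sym (x∈⁅y⁆⇒x≡y y p)) y∈Y) , (λ p → proj₁ (A⊆ p)) ]′ (∈⊕⇒⊎ (Z⊆ x∈Z))
    conclude : ∀ {Z} → Circuit Z → (∀ {x} → x ∈ Z → x ∈ Y) → Fano-like ⊎ Affine-like
    conclude {Z} circ Z⊆Y = map⊎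
      (λ z → size-bound circ flat o z , triangle-coordinates circ flat e∉Z congruent z)
      (λ z → size-bound circ flat o z , quadrangle-coordinates circ flat e∉Z congruent z)
      (circuit-enumeration circ flat e∉Z f∉Z e≢f)
      where
      h∉span : ¬ Span v (_∈ Z) (v h)
      h∉span s = h∉Y (Y-flat (span-map Z⊆Y s))
      flat = circuit-isFlat circ h∉span
      o = CircuitFlat.outside-structure circ flat (h∉span ∘ span-gen)
      open CircuitFlat.Outside o


-- Transport of ranks along a bijection

pullback : (Fin n → Fin m) → Subset m → Subset n
pullback f Y = tabulate (λ i → lookup Y (f i))

∈pullback⁺ : (f : Fin n → Fin m) {Y : Subset m} {x : Fin n} → f x ∈ Y → x ∈ pullback f Y
∈pullback⁺ f {Y} {x} p = Vec.lookup⇒[]= x _ (trans (Vec.lookup∘tabulate _ x) (Vec.[]=⇒lookup p))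

∈pullback⁻ : (f : Fin n → Fin m) {Y : Subset m} {x : Fin n} → x ∈ pullback f Y → f x ∈ Y
∈pullback⁻ f {Y} {x} p = Vec.lookup⇒[]= (f x) Y (trans (sym (Vec.lookup∘tabulate _ x)) (Vec.[]=⇒lookup p))

pullback-inverse : (f : Fin n → Fin m) (g : Fin m → Fin n) → (∀ x → g (f x) ≡ x) →
                   (Y : Subset n) → pullback f (pullback g Y) ≡ Y
pullback-inverse f g gf Y = ⊆-antisym
  (λ {x} p → subst (_∈ Y) (gf x) (∈pullback⁻ g (∈pullback⁻ f p)))
  (λ {x} p → ∈pullback⁺ f (∈pullback⁺ g (subst (_∈ Y) (sym (gf x)) p)))

-- In this form a sum is indexed by all of `Fin n`, and invariance under permutations applies.
sumOver≡sum : (v : Fin n → Vec Bool r) (Y : Subset n) →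
              sumOver v Y ≡ Sum.sum (⊕-commutativeMonoid r) (λ i → lookup Y i · v i)
sumOver≡sum v []      = refl
sumOver≡sum v (y ∷ Y) = trans (sumOver-∷ v y Y) (cong (_ ⊕_) (sumOver≡sum (v ∘ suc) Y))

size≡sum : (Y : Subset n) →
           ∣ Y ∣ ≡ Sum.sum ℕ.+-0-commutativeMonoid (λ i → if lookup Y i then 1 else 0)
size≡sum []          = refl
size≡sum (true ∷ Y)  = cong suc (size≡sum Y)
size≡sum (false ∷ Y) = size≡sum Y

module _ (π : Permutation n m) where
  private
    to = π ⟨$⟩ʳ_
    from = π ⟨$⟩ˡ_

    lookup-pullback : (Y : Subset m) (i : Fin n) → lookup (pullback to Y) i ≡ lookup Y (to i)
    lookup-pullback Y = Vec.lookup∘tabulate (λ i → lookup Y (to i))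

  sumOver-pullback : (w : Fin m → Vec Bool r) (Y : Subset m) →
                     sumOver (w ∘ to) (pullback to Y) ≡ sumOver w Y
  sumOver-pullback {r = r} w Y = begin
    sumOver (w ∘ to) (pullback to Y)                 ≡⟨ sumOver≡sum (w ∘ to) (pullback to Y) ⟩
    sum (λ i → lookup (pullback to Y) i · w (to i))  ≡⟨ sum-cong-≗ (λ i → cong (_· w (to i)) (lookup-pullback Y i)) ⟩
    sum (λ i → lookup Y (to i) · w (to i))           ≡⟨ sum-permute (λ i → lookup Y i · w i) π ⟨
    sum (λ i → lookup Y i · w i)                     ≡⟨ sumOver≡sum w Y ⟨
    sumOver w Y                                      ∎
    where
    open ≡-Reasoning
    open Sum (⊕-commutativeMonoid r)

  size-pullback : (Y : Subset m) → ∣ pullback to Y ∣ ≡ ∣ Y ∣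
  size-pullback Y = begin
    ∣ pullback to Y ∣                                      ≡⟨ size≡sum (pullback to Y) ⟩
    sum (λ i → if lookup (pullback to Y) i then 1 else 0)
      ≡⟨ sum-cong-≗ (λ i → cong (if_then 1 else 0) (lookup-pullback Y i)) ⟩
    sum (λ i → if lookup Y (to i) then 1 else 0)           ≡⟨ sum-permute (λ i → if lookup Y i then 1 else 0) π ⟨
    sum (λ i → if lookup Y i then 1 else 0)                ≡⟨ size≡sum Y ⟨
    ∣ Y ∣                                                  ∎
    where
    open ≡-Reasoning
    open Sum ℕ.+-0-commutativeMonoid

  -- A basis stays independent when pulled back, because a zero sum in the pullback pushes forward
  -- to a zero sum. Used for a permutation and its inverse, this gives equality of ranks.
  rank-≤-pullback : {v : Fin n → Vec Bool r} {w : Fin m → Vec Bool k} {ρᵥ : Subset n → ℕ} {ρ_w : Subset m → ℕ} →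
    IsRank v ρᵥ → IsRank w ρ_w →
    (∀ Z → sumOver v (pullback to Z) ≡ zeroVec → sumOver w Z ≡ zeroVec) →
    ∀ Y → ρ_w Y ≤ ρᵥ (pullback to Y)
  rank-≤-pullback {v = v} {ρᵥ = ρᵥ} Rᵥ R_w zeros Y with I , I⊆Y , ind , eq ← IsRank.basis R_w Y =
    subst (_≤ ρᵥ (pullback to Y)) (trans (size-pullback I) eq)
      (IsRank.bound Rᵥ (λ p → ∈pullback⁺ to (I⊆Y (∈pullback⁻ to p))) independent)
    where
    independent : Independent v (pullback to I)
    independent Q Q⊆ (x , x∈Q) Q≡0 = ind (pullback from Q)
      (λ {y} p → subst (_∈ I) (inverseʳ π) (∈pullback⁻ to (Q⊆ (∈pullback⁻ from p))))
      (to x , ∈pullback⁺ from (subst (_∈ Q) (sym (inverseˡ π)) x∈Q))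
      (zeros (pullback from Q) (trans (cong (sumOver v) (pullback-inverse to from (λ _ → inverseˡ π) Q)) Q≡0))

sumOver-cong : {v w : Fin n → Vec Bool r} → (∀ i → v i ≡ w i) → (Y : Subset n) → sumOver v Y ≡ sumOver w Y
sumOver-cong eq []          = refl
sumOver-cong eq (true ∷ Y)  = cong₂ _⊕_ (eq zero) (sumOver-cong (eq ∘ suc) Y)
sumOver-cong eq (false ∷ Y) = sumOver-cong (eq ∘ suc) Y

sumOver-linear : (b : Fin k → Vec Bool r) (w : Fin n → Vec Bool k) (Y : Subset n) →
                 sumOver (sumOver b ∘ w) Y ≡ sumOver b (sumOver w Y)
sumOver-linear b w []          = sym (sumOver-∅ b)
sumOver-linear b w (true ∷ Y)  =
  trans (cong (_ ⊕_) (sumOver-linear b (w ∘ suc) Y)) (sym (sumOver-⊕ b (w zero) _))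
sumOver-linear b w (false ∷ Y) = sumOver-linear b (w ∘ suc) Y

independent⇒injective : {b : Fin k → Vec Bool r} → Independent b ⊤ → ∀ u → sumOver b u ≡ zeroVec → u ≡ zeroVec
independent⇒injective ind u eq with nonempty? u
... | yes ne   = contradiction eq (ind u ⊆⊤ ne)
... | no empty = Empty-unique empty

injective⇒permutation : (f : Fin n → Fin m) → Injective _≡_ _≡_ f → (∀ j → ∃[ i ] f i ≡ j) → Permutation n m
injective⇒permutation f inj surj =
  permutation f (proj₁ ∘ surj) (proj₂ ∘ surj) (λ i → inj (proj₂ (surj (f i))))

-- A missed `j` could be punched out, leaving an injection into a smaller set.
injective⇒surjective : (f : Fin n → Fin m) → Injective _≡_ _≡_ f → m ≤ n → ∀ j → ∃[ i ] f i ≡ j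
injective⇒surjective {m = suc m} f inj m<n j with Fin.any? (λ i → f i Fin.≟ j)
... | yes hit = hit
... | no miss = contradiction
  (Fin.injective⇒≤ {f = λ i → punchOut (avoid i)} λ {x} {y} eq → inj (Fin.punchOut-injective (avoid x) (avoid y) eq))
  (ℕ.<⇒≱ m<n)
  where
  avoid : ∀ i → j ≢ f i
  avoid i eq = miss (i , sym eq)

isRank-cong : {v : Fin n → Vec Bool r} {ρ₁ ρ₂ : Subset n → ℕ} → (∀ X → ρ₂ X ≡ ρ₁ X) → IsRank v ρ₁ → IsRank v ρ₂
isRank-cong eq R = record
  { basis = λ X → let Y , Y⊆X , ind , size = IsRank.basis R X in Y , Y⊆X , ind , trans size (sym (eq X))
  ; bound = λ {X} Y⊆X ind → ℕ.≤-trans (IsRank.bound R Y⊆X ind) (ℕ.≤-reflexive (sym (eq X))) }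

module _ (M : Matroid n) {v : Fin n → Vec Bool r} (R : IsRank v (ρ M)) (v-injective : Injective _≡_ _≡_ v) where

  -- Independence of `b` makes sums of `v` vanish exactly when the corresponding sums of `w` do. `τ`
  -- is injective because `v` is, and bijective by `m ≤ n`.
  coordinates⇒iso : {w : Fin m → Vec Bool k} {ρ_w : Subset m → ℕ} → IsRank w ρ_w →
                    {b : Fin k → Vec Bool r} → Independent b ⊤ →
                    (τ : Fin n → Fin m) → (∀ g → v g ≡ sumOver b (w (τ g))) → m ≤ n → IsoTo M ρ_w
  coordinates⇒iso {w = w} {ρ_w} R_w {b} ind τ v≡ m≤n = ↔⇒⤖ π , λ Y → ℕ.≤-antisym (lower Y) (upper Y)
    where
    τ-injective : Injective _≡_ _≡_ τ
    τ-injective {x} {y} eq = v-injective (trans (v≡ x) (trans (cong (sumOver b ∘ w) eq) (sym (v≡ y))))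
    π : Permutation n _
    π = injective⇒permutation τ τ-injective (injective⇒surjective τ τ-injective m≤n)
    sums : ∀ Y → sumOver v (pullback τ Y) ≡ sumOver b (sumOver w Y)
    sums Y = trans (sumOver-cong v≡ (pullback τ Y))
      (trans (sumOver-pullback π (sumOver b ∘ w) Y) (sumOver-linear b w Y))
    from = π ⟨$⟩ˡ_
    lower : ∀ Y → ρ_w Y ≤ ρ M (pullback τ Y)
    lower = rank-≤-pullback π R R_w λ Z eq → independent⇒injective ind _ (trans (sym (sums Z)) eq)
    upper : ∀ Y → ρ M (pullback τ Y) ≤ ρ_w Y
    upper Y = subst (λ X → ρ M (pullback τ Y) ≤ ρ_w X)
      (pullback-inverse from τ (λ _ → inverseʳ π) Y)
      (rank-≤-pullback (flip π) R_w R (λ Z eq → begin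
        sumOver v Z                              ≡⟨ cong (sumOver v) (pullback-inverse τ from (λ _ → inverseˡ π) Z) ⟨
        sumOver v (pullback τ (pullback from Z)) ≡⟨ sums (pullback from Z) ⟩
        sumOver b (sumOver w (pullback from Z))  ≡⟨ cong (sumOver b) eq ⟩
        sumOver b zeroVec                        ≡⟨ sumOver-∅ b ⟩
        zeroVec                                  ∎) (pullback τ Y))
      where open ≡-Reasoning

  -- Row j of q lists the columns of w other than the j-th in an order that turns w into w′ after
  -- the change of basis given by the columns at the positions p.
  coordinates⇒iso-or-deletion :
    {w : Fin (suc m) → Vec Bool k} {ρ_w : Subset (suc m) → ℕ} → IsRank w ρ_w →
    {w′ : Fin m → Vec Bool k} {ρ′ : Subset m → ℕ} → IsRank w′ ρ′ →
    (q : Fin (suc m) → Fin m → Fin (suc m)) (p : Fin k → Fin m) →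
    (∀ j i → i ≡ j ⊎ ∃[ h ] q j h ≡ i) →
    (∀ j → Independent (w ∘ q j ∘ p) ⊤) →
    (∀ j h → w (q j h) ≡ sumOver (w ∘ q j ∘ p) (w′ h)) →
    {b : Fin k → Vec Bool r} → Independent b ⊤ →
    (τ : Fin n → Fin (suc m)) → (∀ g → v g ≡ sumOver b (w (τ g))) → m ≤ n →
    IsoTo M ρ′ ⊎ IsoTo M ρ_w
  coordinates⇒iso-or-deletion {m} {w = w} R_w {w′} R′ q p covers q-independent w≡ {b} ind τ v≡ m≤n
    with Fin.any? (λ j → Fin.all? (λ g → ¬? (τ g Fin.≟ j)))
  ... | no all-hit = inj₂ (coordinates⇒iso R_w ind τ v≡ (Fin.injective⇒≤ λ {x} {y} eq →
          trans (sym (proj₂ (hit x))) (trans (cong τ eq) (proj₂ (hit y)))))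
    where
    hit : ∀ j → ∃[ g ] τ g ≡ j
    hit j = decidable-stable (Fin.any? (λ g → τ g Fin.≟ j)) λ miss → all-hit (j , λ g eq → miss (g , eq))
  ... | yes (j , missed) = inj₁ (coordinates⇒iso R′ b′-independent σ v≡′ m≤n)
    where
    preimage : ∀ g → ∃[ h ] q j h ≡ τ g
    preimage g = [ (λ eq → contradiction eq (missed g)) , id ]′ (covers j (τ g))
    σ = proj₁ ∘ preimage
    b′ = sumOver b ∘ w ∘ q j ∘ p
    b′-independent : Independent b′ ⊤
    b′-independent Z Z⊆⊤ ne eq = q-independent j Z Z⊆⊤ ne
      (independent⇒injective ind _ (trans (sym (sumOver-linear b (w ∘ q j ∘ p) Z)) eq))
    v≡′ : ∀ g → v g ≡ sumOver b′ (w′ (σ g))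
    v≡′ g = begin
      v g                                              ≡⟨ v≡ g ⟩
      sumOver b (w (τ g))                              ≡⟨ cong (sumOver b ∘ w) (proj₂ (preimage g)) ⟨
      sumOver b (w (q j (σ g)))                        ≡⟨ cong (sumOver b) (w≡ j (σ g)) ⟩
      sumOver b (sumOver (w ∘ q j ∘ p) (w′ (σ g)))     ≡⟨ sumOver-linear b (w ∘ q j ∘ p) (w′ (σ g)) ⟨
      sumOver b′ (w′ (σ g))                            ∎
      where open ≡-Reasoning

-- The four exceptional matroids

private
  pattern O = false
  pattern I = true

-- For F₇ = [I | P] this is [Pᵀ | I].
F₇* : Vec (Vec Bool 7) 4
F₇* = (I ∷ I ∷ O ∷ I ∷ O ∷ O ∷ O ∷ [])
    ∷ (I ∷ O ∷ I ∷ O ∷ I ∷ O ∷ O ∷ [])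
    ∷ (O ∷ I ∷ I ∷ O ∷ O ∷ I ∷ O ∷ [])
    ∷ (I ∷ I ∷ I ∷ O ∷ O ∷ O ∷ I ∷ [])
    ∷ []

-- Evaluation of both sides on all 128 subsets takes the place of a theory of duality.
ρc≡colRank : ∀ Y → ρc Y ≡ colRank F₇* Y
ρc≡colRank Y = ℕ.≡ᵇ⇒≡ _ _ (Equivalence.from Bool.T-≡
  (all-true⁻ (λ Y → ρc Y ≡ᵇ colRank F₇* Y) (allSubsets 7) (∈-allSubsets Y) refl))

-- `A₆` is the Fano plane without (0,1,1). Accordingly the entries of row `j` at positions 0 and 5,
-- 1 and 2, 3 and 4 are the three lines through the point `j` with `j` removed.
F₇∖ : Fin 7 → Fin 6 → Fin 7
F₇∖ j = lookup (lookup table j)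
  where
  table : Vec (Vec (Fin 7) 6) 7
  table = (# 1 ∷ # 2 ∷ # 4 ∷ # 5 ∷ # 6 ∷ # 3 ∷ [])
        ∷ (# 0 ∷ # 2 ∷ # 5 ∷ # 4 ∷ # 6 ∷ # 3 ∷ [])
        ∷ (# 0 ∷ # 1 ∷ # 5 ∷ # 3 ∷ # 6 ∷ # 4 ∷ [])
        ∷ (# 0 ∷ # 2 ∷ # 6 ∷ # 4 ∷ # 5 ∷ # 1 ∷ [])
        ∷ (# 0 ∷ # 1 ∷ # 6 ∷ # 3 ∷ # 5 ∷ # 2 ∷ [])
        ∷ (# 0 ∷ # 1 ∷ # 2 ∷ # 3 ∷ # 4 ∷ # 6 ∷ [])
        ∷ (# 0 ∷ # 1 ∷ # 4 ∷ # 3 ∷ # 2 ∷ # 5 ∷ [])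
        ∷ []

-- The columns of `F₇*` are the odd vectors of F₂⁴ except (1,1,1,0), the sum of those at positions
-- 3, 4 and 5. Accordingly the columns of `A₈` named by row `j` at these positions add up to column
-- `j`.
A₈∖ : Fin 8 → Fin 7 → Fin 8
A₈∖ j = lookup (lookup table j)
  where
  table : Vec (Vec (Fin 8) 7) 8
  table = (# 1 ∷ # 2 ∷ # 3 ∷ # 4 ∷ # 7 ∷ # 6 ∷ # 5 ∷ [])
        ∷ (# 0 ∷ # 2 ∷ # 3 ∷ # 4 ∷ # 7 ∷ # 5 ∷ # 6 ∷ [])
        ∷ (# 0 ∷ # 1 ∷ # 3 ∷ # 4 ∷ # 6 ∷ # 5 ∷ # 7 ∷ [])
        ∷ (# 0 ∷ # 1 ∷ # 2 ∷ # 7 ∷ # 6 ∷ # 5 ∷ # 4 ∷ [])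
        ∷ (# 0 ∷ # 1 ∷ # 3 ∷ # 2 ∷ # 5 ∷ # 6 ∷ # 7 ∷ [])
        ∷ (# 0 ∷ # 1 ∷ # 2 ∷ # 6 ∷ # 7 ∷ # 3 ∷ # 4 ∷ [])
        ∷ (# 0 ∷ # 1 ∷ # 2 ∷ # 5 ∷ # 3 ∷ # 7 ∷ # 4 ∷ [])
        ∷ (# 0 ∷ # 1 ∷ # 2 ∷ # 3 ∷ # 5 ∷ # 6 ∷ # 4 ∷ [])
        ∷ []

-- The unit columns stand first in `A₆` and last in `F₇*`.
A₆-basis : Fin 3 → Fin 6
A₆-basis = lookup (# 0 ∷ # 1 ∷ # 2 ∷ [])

F₇*-basis : Fin 4 → Fin 7
F₇*-basis = lookup (# 3 ∷ # 4 ∷ # 5 ∷ # 6 ∷ [])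

covers? : (q : Fin m → Fin n → Fin m) → Dec (∀ j i → i ≡ j ⊎ ∃[ h ] q j h ≡ i)
covers? q = Fin.all? λ j → Fin.all? λ i → i Fin.≟ j ⊎-dec Fin.any? λ h → q j h Fin.≟ i

independent? : (b : Fin m → Fin k → Vec Bool r) → Dec (∀ j → independentᵇ (b j) ⊤ ≡ true)
independent? b = Fin.all? λ j → independentᵇ (b j) ⊤ Bool.≟ true

change-of-basis? : (w : Fin m → Fin n → Vec Bool r) (b : Fin m → Fin k → Vec Bool r) (w′ : Fin n → Vec Bool k) →
                   Dec (∀ j h → w j h ≡ sumOver (b j) (w′ h))
change-of-basis? w b w′ = Fin.all? λ j → Fin.all? λ h → w j h ≟ᵛ sumOver (b j) (w′ h)

column? : (A : Vec (Vec Bool n) r) (u : Vec Bool r) → Dec (∃[ j ] column A j ≡ u)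
column? A u = Fin.any? λ j → column A j ≟ᵛ u

nonzero⇒column-F₇ : ∀ u → u ≢ zeroVec → ∃[ j ] column F₇ j ≡ u
nonzero⇒column-F₇ u u≢0 = decidable-stable (column? F₇ u) λ none →
  toWitnessFalse {a? = anySubset? λ u → ¬? (u ≟ᵛ zeroVec) ×-dec ¬? (column? F₇ u)} _ (u , u≢0 , none)

odd⇒column-A₈ : ∀ u → parity u ≡ true → ∃[ j ] column A₈ j ≡ u
odd⇒column-A₈ u odd = decidable-stable (column? A₈ u) λ none →
  toWitnessFalse {a? = anySubset? λ u → parity u Bool.≟ true ×-dec ¬? (column? A₈ u)} _ (u , odd , none)

-- The theorem: from rank conditions to spans

theorem8p10 : (n : ℕ) (M : Matroid n) →
    Binary M → Simple M → (∀ e → Isthmus M e → ⊥) → Height3 M →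
    η M ⊤ ≡ 2 ⊎ IsoTo M ρa ⊎ IsoTo M ρb ⊎ IsoTo M ρc ⊎ IsoTo M ρd
-- The middle member `Y` of the chain is nonempty, by `y`, and proper, by `h`.
theorem8p10 n M (r , v , ρ≡) (loopless , parallel-free) isthmus-free
  ((X , Y , W , _ , Y-cf , _ , (_ , y , y∈Y , _) , (_ , h , _ , h∉Y)) , no-chain4)
  with η M ⊤ ℕ.≟ 2
... | yes η≡2 = inj₁ η≡2
... | no η≢2 = inj₂ (conclude (classification (flat⁻ (proj₁ Y-cf)) (cyclic⁻ (proj₂ Y-cf)) y∈Y h∉Y))
  where
  R : IsRank v (ρ M)
  R = isRank-cong ρ≡ (rankF2-isRank v)
  open Rank R
  open Configuration v

  ρ∅≤0 : ρ M ∅ ≤ 0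
  ρ∅≤0 = ℕ.≤-trans (rank≤size ∅) (ℕ.≤-reflexive (∣⊥∣≡0 n))

  ρ-step : ∀ X e → ρ M (X ∪ ⁅ e ⁆) ≤ ρ M X → ρ M (X ∪ ⁅ e ⁆) ≡ ρ M X
  ρ-step X e ρ≤ = ℕ.≤-antisym ρ≤ (rank-mono (p⊆p∪q ⁅ e ⁆))

  not-loop : ∀ e → ρ M (∅ ∪ ⁅ e ⁆) ≤ ρ M ∅ → ⊥
  not-loop e ρ≤ = loopless e (ℕ.n≤0⇒n≡0 (subst (λ X → ρ M X ≤ 0) (∪-identityˡ ⁅ e ⁆) (ℕ.≤-trans ρ≤ ρ∅≤0)))

  no-loop : ∀ e → v e ≢ zeroVec
  no-loop e eq = not-loop e (span⇒rank (subst (Span v _) (sym eq) []))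

  no-parallel : Injective _≡_ _≡_ v
  no-parallel {e} {f} eq = decidable-stable (e Fin.≟ f) λ e≢f → parallel-free e f (e≢f , ℕ.≤-antisym
    (ℕ.≤-trans (span⇒rank (subst (Span v _) eq (span-gen (x∈⁅x⁆ e))))
      (ℕ.≤-trans (rank≤size ⁅ e ⁆) (ℕ.≤-reflexive (∣⁅x⁆∣≡1 e))))
    (ℕ.≤-trans (ℕ.n≢0⇒n>0 (loopless e)) (rank-mono (p⊆p∪q ⁅ f ⁆))))

  no-isthmus : ∀ e → Span v (_≢ e) (v e)
  no-isthmus e = span-map (proj₂ ∘ x∈p-y⁻) (rank⇒span (subst (λ X → ρ M X ≤ ρ M (⊤ - e))
    (sym (p-x∪x≡p ∈⊤)) (ℕ.≮⇒≥ (isthmus-free e))))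

  flat⁻ : ∀ {X} → Flat M X → IsFlat X
  flat⁻ {X} flat {e} s = flat e (ρ-step X e (span⇒rank s))

  flat⁺ : ∀ {X} → IsFlat X → Flat M X
  flat⁺ flat e eq = flat (rank⇒span (ℕ.≤-reflexive eq))

  cyclic⁻ : ∀ {X} → Cyclic M X → IsCyclic X
  cyclic⁻ {X} cyc {e} e∈X = span-map x∈p-y⁻
    (rank⇒span (ℕ.≤-reflexive (trans (cong (ρ M) (p-x∪x≡p e∈X)) (sym (cyc e e∈X)))))

  cyclic⁺ : ∀ {X} → IsCyclic X → Cyclic M X
  cyclic⁺ {X} cyc e e∈X = sym (trans (cong (ρ M) (sym (p-x∪x≡p e∈X)))
    (ρ-step (X - e) e (span⇒rank (span-map (λ (p , q) → x∈p∧x≢y⇒x∈p-y p q) (cyc e∈X)))))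

  no-chain : ∀ {X Y g} → IsFlat X → IsCyclic X → IsFlat Y → IsCyclic Y → Nonempty X → X ⊂ Y → g ∉ Y → ⊥
  no-chain {X} {Y} {g} X-flat X-cyc Y-flat Y-cyc (x , x∈X) X⊂Y g∉Y = no-chain4
    ( ∅ , X , Y , ⊤
    , ((λ e eq → ⊥-elim (not-loop e (ℕ.≤-reflexive eq))) , λ e e∈∅ → contradiction e∈∅ ∉⊥)
    , (flat⁺ X-flat , cyclic⁺ X-cyc) , (flat⁺ Y-flat , cyclic⁺ Y-cyc)
    , ((λ _ _ → ∈⊤) , cyclic⁺ (λ {e} _ → span-map (∈⊤ ,_) (no-isthmus e)))
    , (⊥⊆ , x , x∈X , ∉⊥) , X⊂Y , (⊆⊤ , g , ∈⊤ , g∉Y) )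

  nullity≢2 : ∀ {s t} → s ≢ t → Span v (λ x → x ≢ s × x ≢ t) (v s) →
              Span v (λ x → x ≢ s × x ≢ t) (v t) → Independent v ((⊤ - s) - t) → ⊥
  nullity≢2 s≢t ss st ind = η≢2 (nullity-two s≢t ss st ind)

  open Classify v no-loop no-parallel no-isthmus no-chain nullity≢2

  conclude : Fano-like ⊎ Affine-like → IsoTo M ρa ⊎ IsoTo M ρb ⊎ IsoTo M ρc ⊎ IsoTo M ρd
  conclude (inj₁ (6≤n , b , ind , coord)) =
    [ inj₁ , inj₂ ∘ inj₁ ]′ (coordinates⇒iso-or-deletion M R no-parallel
      (rankF2-isRank (column F₇)) (rankF2-isRank (column A₆)) F₇∖ A₆-basis
      -- The properties of the tables are verified by running the decision procedures.
      (toWitness {a? = covers? F₇∖} _)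
      (λ j → independentᵇ-sound _ (toWitness {a? = independent? λ j → column F₇ ∘ F₇∖ j ∘ A₆-basis} _ j))
      (toWitness {a? = change-of-basis? (λ j → column F₇ ∘ F₇∖ j) (λ j → column F₇ ∘ F₇∖ j ∘ A₆-basis) (column A₆)} _)
      ind (proj₁ ∘ col) (λ g → trans (proj₂ (coord g)) (cong (sumOver _) (sym (proj₂ (col g))))) 6≤n)
    where
    col : ∀ g → ∃[ j ] column F₇ j ≡ proj₁ (coord g)
    col g = nonzero⇒column-F₇ _ λ u≡0 → no-loop g
      (trans (proj₂ (coord g)) (trans (cong (sumOver _) u≡0) (sumOver-∅ (v ∘ lookup b))))
  conclude (inj₂ (7≤n , b , ind , coord)) =
    inj₂ (inj₂ (coordinates⇒iso-or-deletion M R no-parallel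
      (rankF2-isRank (column A₈)) (isRank-cong ρc≡colRank (rankF2-isRank (column F₇*))) A₈∖ F₇*-basis
      (toWitness {a? = covers? A₈∖} _)
      (λ j → independentᵇ-sound _ (toWitness {a? = independent? λ j → column A₈ ∘ A₈∖ j ∘ F₇*-basis} _ j))
      (toWitness {a? = change-of-basis? (λ j → column A₈ ∘ A₈∖ j) (λ j → column A₈ ∘ A₈∖ j ∘ F₇*-basis) (column F₇*)} _)
      ind (proj₁ ∘ col) (λ g → trans (proj₁ (proj₂ (coord g))) (cong (sumOver _) (sym (proj₂ (col g))))) 7≤n))
    where
    col : ∀ g → ∃[ j ] column A₈ j ≡ proj₁ (coord g)
    col g = odd⇒column-A₈ _ (proj₂ (proj₂ (coord g)))
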